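{- Let $D=(V,A)$ be a countable digraph (multiple edges and loops allowed) and let $s\neq t\in V$. Suppose that for every $v\in V$ there is a finitary matroid $\mathcal{M}_v$ on the set $\mathsf{in}_D(v)$ of edges with head $v$, and let $\mathcal{M}=\bigoplus_{v\in V}\mathcal{M}_v$ (a matroid on $A$). Then there is a system $\mathcal{P}$ of pairwise edge-disjoint $s\rightarrow t$ paths such that $\bigcup_{P\in\mathcal{P}}A(P)$ is independent in $\mathcal{M}$, and there is an edge set $C\subseteq A$ consisting of exactly one edge from each element of $\mathcal{P}$ such that $\mathsf{span}_{\mathcal{M}}(C)$ covers all $s\rightarrow t$ paths of $D$ (i.e. every $s\rightarrow t$ path in $D$ has an edge in $\mathsf{span}_{\mathcal{M}}(C)$).
   Context: Paths are finite directed paths with no repeated vertices; $A(P)$ is the edge set of the path $P$. A matroid is finitary if all its circuits are finite. $\mathsf{span}_{\mathcal{M}}(S)$ is the closure of $S$ in $\mathcal{M}$ (the union of $S$ and all elements $e$ such that $S+e$ contains a circuit through $e$, equivalently the loops of $\mathcal{M}/S$). -}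

module Defs where

open import Level using (0ℓ; suc; Lift)
open import Data.Nat using (ℕ; _<_) renaming (suc to sucℕ)
open import Data.List using (List; []; _∷_; length; map)
open import Data.List.Membership.Propositional using () renaming (_∈_ to _∈ˡ_)
open import Data.List.Relation.Unary.Unique.Propositional using (Unique)
open import Data.Product using (Σ; ∃; _×_; _,_; proj₁)
open import Data.Sum using (_⊎_)
open import Relation.Nullary using (¬_; Dec)
open import Relation.Unary using (Pred; _⊆_; _∈_; _∉_; ∅; _∪_; ｛_｝)
open import Relation.Binary.PropositionalEquality using (_≡_; _≢_)
open import Function.Bundles using (_↣_)

toSet : {E : Set} → List E → Pred E 0ℓ
toSet L = λ x → x ∈ˡ L

record FinitaryMatroid (E : Set) : Set₁ where
  field
    Indep    : Pred E 0ℓ → Set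
    indep-∅  : Indep ∅
    indep-⊆  : ∀ {X Y : Pred E 0ℓ} → Y ⊆ X → Indep X → Indep Y
    augment  : ∀ (I J : List E) → Unique I → Unique J →
               Indep (toSet I) → Indep (toSet J) → length I < length J →
               ∃ λ e → e ∈ˡ J × ¬ (e ∈ˡ I) × Indep (toSet (e ∷ I))
    finitary : ∀ (X : Pred E 0ℓ) →
               (∀ (L : List E) → toSet L ⊆ X → Indep (toSet L)) → Indep X

IsCircuit : {E : Set} → (Pred E 0ℓ → Set) → Pred E 0ℓ → Set₁
IsCircuit {E} Ind K = ¬ Ind K × (∀ (Y : Pred E 0ℓ) → Y ⊆ K → ¬ (K ⊆ Y) → Ind Y)

span : {E : Set} → (Pred E 0ℓ → Set) → Pred E 0ℓ → E → Set₁
span {E} Ind S e = Lift (suc 0ℓ) (e ∈ S) ⊎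
  Σ (Pred E 0ℓ) (λ K → IsCircuit Ind K × e ∈ K × K ⊆ (S ∪ ｛ e ｝))

Countable : Set → Set
Countable X = X ↣ ℕ

record Digraph : Set₁ where
  field
    V    : Set
    A    : Set
    tail : A → V
    head : A → V

module _ (D : Digraph) where
  open Digraph D

  In : V → Set
  In v = Σ A (λ e → head e ≡ v)

  ⊕Indep : ((v : V) → FinitaryMatroid (In v)) → Pred A 0ℓ → Set
  ⊕Indep M X = ∀ (v : V) → FinitaryMatroid.Indep (M v) (λ p → proj₁ p ∈ X)

  data Walk : V → V → List A → Set where
    walk-nil  : ∀ {v} → Walk v v []
    walk-cons : ∀ {u w e es} → tail e ≡ u → Walk (head e) w es → Walk u w (e ∷ es)

  IsPath : V → V → List A → Set
  IsPath u w es = Walk u w es × Unique (u ∷ map head es)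

{-# OPTIONS --safe #-}
-- A wave is a system of disjoint paths leaving the current last edges S, independent together with all
-- edges used so far, whose own last edges span a cut to t; the state is hindered if some wave abandons an
-- edge of S.  Following hindering waves for ω steps ends in an unhindered state, and C is its set of last
-- edges.  Any one path of an unhindered state can be continued to t with the state staying unhindered: grow
-- a tree of edges from its end, taking at each step either an adjacent edge z or, if adding z would make
-- the state hindered, a wave spanning z, which exists by an augmenting walk from the abandoned edge.  If the
-- tree never met t, the limit of these waves would be a wave abandoning the original edge.  Continuing
-- each path from C in turn gives the path system.  Limits behave because circuits are finite.
module Submission where

open import Defs
open import Level using (0ℓ; Lift; lift) renaming (suc to lsuc)
open import Data.Nat using (ℕ; zero; suc; _+_; _∸_; _≤_; _<_; _≤?_; z≤n; s≤s; _⊔_)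
open import Data.Nat.Properties using (≰⇒>; ≤-total; ≤-refl; ≤-trans; ≤-reflexive; m≤m⊔n; m≤n⊔m; n≤1+n; n<1+n; m≤n⇒m<n∨m≡n; m≤m+n; m≤n+m; m∸n+n≡m; m+n∸n≡m; ∸-monoˡ-≤; +-suc; +-identityʳ)
open import Data.Nat.Induction using (<-rec)
open import Data.List using (List; []; _∷_; length; map; _++_)
open import Data.List.Membership.Propositional using () renaming (_∈_ to _∈ˡ_)
open import Data.List.Membership.Propositional.Properties using (∈-map⁺; ∈-map⁻; ∈-++⁻)
open import Data.List.Relation.Unary.Any using (here; there)
open import Data.List.Relation.Unary.All using (All; []; _∷_)
open import Data.List.Relation.Unary.All.Properties using (¬Any⇒All¬)
open import Data.List.Relation.Unary.AllPairs using ([]; _∷_)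
open import Data.List.Relation.Unary.Unique.Propositional using (Unique)
open import Data.Maybe using (Maybe; just; nothing)
open import Data.Product using (Σ; ∃; _×_; _,_; proj₁; proj₂)
open import Data.Sum using (_⊎_; inj₁; inj₂; map₁; map₂)
open import Data.Empty using (⊥; ⊥-elim)
open import Function.Bundles using (Injection)
open import Relation.Nullary using (¬_; Dec; yes; no)
open import Relation.Unary using (Pred; _⊆_; _∈_)
open import Relation.Binary.PropositionalEquality using (_≡_; _≢_; refl; sym; trans; cong; subst)

-- The main argument runs on edges alone. Edges with equal heads have the same continuations, and
-- the matroids enter only through a closure operator with exchange, finite witnesses and locality:
-- whether an edge is spanned depends only on edges with the same head. Locality ties the matroids
-- to the digraph. If a set spans `e` and a smaller one does not, some `d` in the difference shares
-- the head of `e`, so a walk to t that leaves `e` also leaves `d`. Likewise, when `f` is exchanged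
-- for `c`, the continuation of `c` can be hung below `f`. The shape of the data is dictated by
-- limits. Path systems are stored as a set of new edges with a predecessor map, so that a limit is
-- a union. Edges of abandoned segments may stay in `X`, so that closures only grow; sealing
-- guarantees that they give no way to t around the cut. The starting edges are a basis of the edges
-- leaving s, so every path from s to t begins with an edge spanned by the initial state.

module Classical (lem : (P : Set₁) → Dec P) where

  dec : (P : Set) → Dec P
  dec P with lem (Lift (lsuc 0ℓ) P)
  ... | yes (lift p) = yes p
  ... | no ¬p        = no λ p → ¬p (lift p)

  dne : {P : Set} → ¬ ¬ P → P
  dne {P} ¬¬p with dec P
  ... | yes p = p
  ... | no ¬p = ⊥-elim (¬¬p ¬p)

infixl 6 _⊕_ _⊖_
infixl 5 _∪ᵖ_

_⊕_ _⊖_ : {A : Set} → Pred A 0ℓ → A → Pred A 0ℓ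
(X ⊕ a) x = X x ⊎ x ≡ a
(X ⊖ a) x = X x × x ≢ a

_∪ᵖ_ _∖ᵖ_ : {A : Set} → Pred A 0ℓ → Pred A 0ℓ → Pred A 0ℓ
(X ∪ᵖ Y) x = X x ⊎ Y x
(X ∖ᵖ Y) x = X x × ¬ Y x

-- The closure operator of one finitary matroid

module Closure (lem : (P : Set₁) → Dec P) {E : Set} (M : FinitaryMatroid E) where
  open FinitaryMatroid M
  open Classical lem

  _≤ˡ_ : List E → List E → Set
  I ≤ˡ J = ∀ x → x ∈ˡ I → x ∈ˡ J

  ∷-mono : ∀ {I J e} → I ≤ˡ J → (e ∷ I) ≤ˡ (e ∷ J)
  ∷-mono h x (here q)  = here q
  ∷-mono h x (there m) = there (h x m)

  sub : ∀ {I J} → I ≤ˡ J → Indep (toSet J) → Indep (toSet I)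
  sub h = indep-⊆ λ {x} → h x

  uniq∷ : ∀ {x} {I : List E} → ¬ (x ∈ˡ I) → Unique I → Unique (x ∷ I)
  uniq∷ x∉ u = ¬Any⇒All¬ _ x∉ ∷ u

  Basic : List E → Set
  Basic I = Unique I × Indep (toSet I)

  Spanned : List E → E → Set
  Spanned I e = e ∈ˡ I ⊎ ¬ Indep (toSet (e ∷ I))

  spanned-mono : ∀ {I J e} → I ≤ˡ J → Spanned I e → Spanned J e
  spanned-mono h (inj₁ m) = inj₁ (h _ m)
  spanned-mono h (inj₂ d) = inj₂ λ i → d (sub (∷-mono h) i)

  extend : ∀ Q I → Basic I → Σ (List E) λ J → Basic J × I ≤ˡ J ×
           (∀ x → x ∈ˡ J → x ∈ˡ I ⊎ x ∈ˡ Q) × (∀ q → q ∈ˡ Q → Spanned J q)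
  extend [] I b = I , b , (λ x m → m) , (λ x → inj₁) , λ q ()
  extend (q ∷ Q) I b with extend Q I b
  ... | J , (u , i) , I≤J , J≤ , sp with dec (Spanned J q)
  ... | yes s = J , (u , i) , I≤J , J≤′ , sp′
    where
    J≤′ : ∀ x → x ∈ˡ J → x ∈ˡ I ⊎ x ∈ˡ q ∷ Q
    J≤′ x m with J≤ x m
    ... | inj₁ a = inj₁ a
    ... | inj₂ a = inj₂ (there a)
    sp′ : ∀ r → r ∈ˡ q ∷ Q → Spanned J r
    sp′ r (here refl) = s
    sp′ r (there m)   = sp r m
  ... | no ¬s = q ∷ J , (uniq∷ (λ m → ¬s (inj₁ m)) u , dne λ d → ¬s (inj₂ d))
              , (λ x m → there (I≤J x m)) , J≤′ , sp′
    where
    J≤′ : ∀ x → x ∈ˡ q ∷ J → x ∈ˡ I ⊎ x ∈ˡ q ∷ Q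
    J≤′ x (here refl) = inj₂ (here refl)
    J≤′ x (there m) with J≤ x m
    ... | inj₁ a = inj₁ a
    ... | inj₂ a = inj₂ (there a)
    sp′ : ∀ r → r ∈ˡ q ∷ Q → Spanned (q ∷ J) r
    sp′ r (here refl) = inj₁ (here refl)
    sp′ r (there m)   = spanned-mono (λ x → there) (sp r m)

  -- If e were not spanned by X, then X + e would outgrow a maximal extension
  -- of Y inside X ∪ Y, although X is itself maximal there.
  spanned-trans : ∀ {X Y e} → Basic X → Basic Y → (∀ y → y ∈ˡ Y → Spanned X y) →
                  Spanned Y e → Spanned X e
  spanned-trans {X} {Y} {e} (uX , iX) bY Y≤X sY with dec (Spanned X e)
  ... | yes s = s
  ... | no ¬s with extend X Y bY
  ... | Y′ , (u , i) , Y≤Y′ , Y′≤ , sp with length Y′ ≤? length X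
  ... | no Y′≰X with augment X Y′ uX u iX i (≰⇒> Y′≰X)
  ... | y , y∈ , y∉ , ind with Y′≤ y y∈
  ... | inj₂ m = ⊥-elim (y∉ m)
  ... | inj₁ m with Y≤X y m
  ... | inj₁ m′ = ⊥-elim (y∉ m′)
  ... | inj₂ d  = ⊥-elim (d ind)
  spanned-trans {X} {Y} {e} (uX , iX) bY Y≤X sY | no ¬s | Y′ , (u , i) , Y≤Y′ , Y′≤ , sp | yes Y′≤X
    with augment Y′ (e ∷ X) u (uniq∷ (λ m → ¬s (inj₁ m)) uX) i (dne λ d → ¬s (inj₂ d)) (s≤s Y′≤X)
  ... | z , there z∈ , z∉ , ind with sp z z∈
  ... | inj₁ m = ⊥-elim (z∉ m)
  ... | inj₂ d = ⊥-elim (d ind)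
  spanned-trans (uX , iX) bY Y≤X sY | no ¬s | Y′ , (u , i) , Y≤Y′ , Y′≤ , sp | yes Y′≤X
      | z , here refl , z∉ , ind with spanned-mono Y≤Y′ sY
  ... | inj₁ m = ⊥-elim (z∉ m)
  ... | inj₂ d = ⊥-elim (d ind)

  -- The witness is a finite independent list, so finite character is built in and membership lies
  -- in `Set`, whereas `span` ranges over circuits and lies in `Set₁`.
  cl : Pred E 0ℓ → Pred E 0ℓ
  cl X e = Σ (List E) λ I → Basic I × (∀ x → x ∈ˡ I → X x) × Spanned I e

  cl-mono : ∀ {X Y e} → (∀ x → X x → Y x) → cl X e → cl Y e
  cl-mono h (I , b , I≤ , s) = I , b , (λ x m → h x (I≤ x m)) , s

  basic-[] : Basic []
  basic-[] = [] , indep-⊆ (λ ()) indep-∅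

  cl-ext : ∀ {X e} → X e → cl X e
  cl-ext {X} {e} Xe with dec (Indep (toSet (e ∷ [])))
  ... | yes i = e ∷ [] , (uniq∷ (λ ()) [] , i) , (λ { x (here refl) → Xe }) , inj₁ (here refl)
  ... | no d  = [] , basic-[] , (λ x ()) , inj₂ d

  cl-fin : ∀ {X e} → cl X e → Σ (List E) λ I → (∀ x → x ∈ˡ I → X x) × cl (toSet I) e
  cl-fin (I , b , I≤ , s) = I , I≤ , (I , b , (λ x m → m) , s)

  -- Merges the separate witnesses into one list, which reduces transitivity of `cl` to the finite
  -- `spanned-trans`.
  collect : ∀ {X} I → (∀ x → x ∈ˡ I → cl X x) →
            Σ (List E) λ J → Basic J × (∀ x → x ∈ˡ J → X x) × (∀ x → x ∈ˡ I → Spanned J x)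
  collect [] h = [] , basic-[] , (λ x ()) , λ x ()
  collect {X} (i ∷ I) h with collect I (λ x m → h x (there m)) | h i (here refl)
  ... | J , b , J≤ , sp | Iᵢ , bᵢ , Iᵢ≤ , sᵢ with extend Iᵢ J b
  ... | J′ , b′ , J≤J′ , J′≤ , sp′ = J′ , b′ , J′⊆ , spᵢ
    where
    J′⊆ : ∀ x → x ∈ˡ J′ → X x
    J′⊆ x m with J′≤ x m
    ... | inj₁ a = J≤ x a
    ... | inj₂ a = Iᵢ≤ x a
    spᵢ : ∀ x → x ∈ˡ i ∷ I → Spanned J′ x
    spᵢ x (here refl) = spanned-trans b′ bᵢ sp′ sᵢ
    spᵢ x (there m)   = spanned-mono J≤J′ (sp x m)

  cl-trans : ∀ {X Y e} → (∀ y → Y y → cl X y) → cl Y e → cl X e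
  cl-trans h (I , b , I≤ , s) with collect I (λ x m → h x (I≤ x m))
  ... | J , bJ , J≤ , sp = J , bJ , J≤ , spanned-trans bJ b sp s

  -- A new element that made the list dependent would be spanned by the other elements of `X`.
  dedup : ∀ {X} → (∀ x → X x → ¬ cl (X ⊖ x) x) → ∀ L → (∀ x → x ∈ˡ L → X x) →
          Σ (List E) λ I → Basic I × L ≤ˡ I × I ≤ˡ L
  dedup h [] L≤ = [] , basic-[] , (λ x ()) , λ x ()
  dedup {X} h (x ∷ L) L≤ with dedup h L (λ y m → L≤ y (there m))
  ... | I , (u , i) , L≤I , I≤L with dec (x ∈ˡ I)
  ... | yes x∈ = I , (u , i) , (λ { y (here refl) → x∈ ; y (there m) → L≤I y m }) , λ y m → there (I≤L y m)
  ... | no x∉ = x ∷ I , (uniq∷ x∉ u , ind) , ∷-mono L≤I , ∷-mono I≤L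
    where
    ind : Indep (toSet (x ∷ I))
    ind = dne λ d → h x (L≤ x (here refl))
      (I , (u , i) , (λ y m → L≤ y (there (I≤L y m)) , λ { refl → x∉ m }) , inj₂ d)

  free⇒indep : ∀ {X} → (∀ x → X x → ¬ cl (X ⊖ x) x) → Indep X
  free⇒indep {X} h = finitary X λ L L⊆ →
    let I , (u , i) , L≤I , _ = dedup h L (λ x → L⊆) in sub L≤I i

  indep⇒free : ∀ {X} → Indep X → ∀ x → X x → ¬ cl (X ⊖ x) x
  indep⇒free i x Xx (I , b , I≤ , inj₁ m) = proj₂ (I≤ x m) refl
  indep⇒free i x Xx (I , b , I≤ , inj₂ d) =
    d (indep-⊆ (λ { (here refl) → Xx ; (there m) → proj₁ (I≤ _ m) }) i)

  remove : ∀ f (I : List E) → Basic I → Σ (List E) λ J → Basic J × (∀ x → x ∈ˡ J → x ∈ˡ I × x ≢ f) ×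
           (∀ x → x ∈ˡ I → x ≢ f → x ∈ˡ J)
  remove f [] b = [] , b , (λ x ()) , λ x ()
  remove f (y ∷ I) (y∉ ∷ u , i) with remove f I (u , sub (λ x → there) i)
  ... | J , (uJ , _) , J≤ , ≤J with dec (y ≡ f)
  ... | yes refl = J , (uJ , sub (λ x m → there (proj₁ (J≤ x m))) i)
                 , (λ x m → there (proj₁ (J≤ x m)) , proj₂ (J≤ x m))
                 , λ { x (here refl) ne → ⊥-elim (ne refl) ; x (there m) ne → ≤J x m ne }
  ... | no y≢f = y ∷ J , (uniq∷ (λ m → notin y∉ (proj₁ (J≤ y m))) uJ , sub (∷-mono λ x m → proj₁ (J≤ x m)) i)
               , (λ { x (here refl) → here refl , y≢f ; x (there m) → there (proj₁ (J≤ x m)) , proj₂ (J≤ x m) })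
               , λ { x (here refl) ne → here refl ; x (there m) ne → there (≤J x m ne) }
    where
    notin : ∀ {L} → All (y ≢_) L → ¬ (y ∈ˡ L)
    notin (ne ∷ a) (here q)  = ne q
    notin (ne ∷ a) (there m) = notin a m

  -- Without `f` the witness lies in `X`, so adding `e` keeps it independent; adding `f` as well
  -- gives back the dependent `e ∷ I`.
  cl-exch : ∀ {X f e} → cl (X ⊕ f) e → ¬ cl X e → cl (X ⊕ e) f
  cl-exch {X} {f} {e} (I , b , I≤ , s) ¬c with dec (e ≡ f)
  ... | yes refl = cl-ext (inj₂ refl)
  ... | no e≢f with remove f I b
  ... | J , (uJ , iJ) , J≤ , ≤J = e ∷ J , (uniq∷ e∉J uJ , ind) , J⊕ , inj₂ (clash s)
    where
    J⊆X : ∀ x → x ∈ˡ J → X x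
    J⊆X x m with I≤ x (proj₁ (J≤ x m))
    ... | inj₁ a = a
    ... | inj₂ q = ⊥-elim (proj₂ (J≤ x m) q)
    e∉J : ¬ (e ∈ˡ J)
    e∉J m = ¬c (cl-ext (J⊆X e m))
    ind : Indep (toSet (e ∷ J))
    ind = dne λ d → ¬c (J , (uJ , iJ) , J⊆X , inj₂ d)
    J⊕ : ∀ x → x ∈ˡ e ∷ J → (X ⊕ e) x
    J⊕ x (here q)  = inj₂ q
    J⊕ x (there m) = inj₁ (J⊆X x m)
    I≤f : ∀ x → x ∈ˡ e ∷ I → x ∈ˡ f ∷ e ∷ J
    I≤f x (here q) = there (here q)
    I≤f x (there m) with dec (x ≡ f)
    ... | yes q = here q
    ... | no ne = there (there (≤J x m ne))
    clash : Spanned I e → ¬ Indep (toSet (f ∷ e ∷ J))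
    clash (inj₁ m) i = e∉J (≤J e m e≢f)
    clash (inj₂ d) i = d (sub I≤f i)

-- The closure operator of the direct sum

module SumClosure (lem : (P : Set₁) → Dec P) (D : Digraph)
                  (M : (v : Digraph.V D) → FinitaryMatroid (In D v)) where
  open Digraph D
  open Classical lem
  module C (v : V) = Closure lem (M v)

  at : Pred A 0ℓ → (v : V) → Pred (In D v) 0ℓ
  at X v p = X (proj₁ p)

  abstract
    cl : Pred A 0ℓ → Pred A 0ℓ
    cl X e = C.cl (head e) (at X (head e)) (e , refl)

    cl-mono : ∀ {X Y e} → (∀ x → X x → Y x) → cl X e → cl Y e
    cl-mono h = C.cl-mono _ λ p → h (proj₁ p)

    cl-ext : ∀ {X e} → X e → cl X e
    cl-ext Xe = C.cl-ext _ Xe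

    cl-trans : ∀ {X Y e} → (∀ y → Y y → cl X y) → cl Y e → cl X e
    cl-trans h = C.cl-trans _ λ { (y , q) Yy → lift-eq y q (h y Yy) }
      where
      lift-eq : ∀ {X v} y (q : head y ≡ v) → cl X y → C.cl v (at X v) (y , q)
      lift-eq y refl c = c

    cl-local : ∀ {X e} → cl X e → cl (λ x → X x × head x ≡ head e) e
    cl-local {e = e} = C.cl-mono (head e) λ { (x , q) Xx → Xx , q }

    -- If e and f have different heads, f lies outside the summand deciding cl _ e.
    cl-exch : ∀ {X f e} → cl (X ⊕ f) e → ¬ cl X e → cl (X ⊕ e) f
    cl-exch {X} {f} {e} c ¬c with dec (head f ≡ head e)
    ... | no ne = ⊥-elim (¬c (C.cl-mono (head e)
            (λ { (x , q) (inj₁ a) → a ; (x , q) (inj₂ refl) → ⊥-elim (ne q) }) c))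
    ... | yes q = go (head e) refl q c ¬c
      where
      go : ∀ v (qe : head e ≡ v) (qf : head f ≡ v) → C.cl v (at (X ⊕ f) v) (e , qe) →
           ¬ C.cl v (at X v) (e , qe) → cl (X ⊕ e) f
      go v qe refl c ¬c = C.cl-mono v widen (C.cl-exch v (C.cl-mono v narrow c) ¬c)
        where
        narrow : ∀ p → at (X ⊕ f) v p → (at X v ⊕ (f , refl)) p
        narrow (x , q)    (inj₁ a)    = inj₁ a
        narrow (.f , refl) (inj₂ refl) = inj₂ refl
        widen : ∀ p → (at X v ⊕ (e , qe)) p → at (X ⊕ e) v p
        widen p (inj₁ a)     = inj₁ a
        widen p (inj₂ refl) = inj₂ refl

    cl-fin : ∀ {X e} → cl X e → Σ (List A) λ I → (∀ x → x ∈ˡ I → X x) × cl (toSet I) e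
    cl-fin {X} {e} c with C.cl-fin (head e) c
    ... | I , I≤ , c′ = map proj₁ I , below , C.cl-mono (head e) (λ p → ∈-map⁺ proj₁) c′
      where
      below : ∀ x → x ∈ˡ map proj₁ I → X x
      below x m with ∈-map⁻ proj₁ m
      ... | p , p∈ , refl = I≤ p p∈

    free⇒indep : ∀ {X} → (∀ x → X x → ¬ cl (X ⊖ x) x) → ⊕Indep D M X
    free⇒indep {X} h v = C.free⇒indep v λ { (x , refl) Xx c →
      h x Xx (C.cl-mono v (λ { (y , q) (Xy , ne) → Xy , λ { refl → ne (same q) } }) c) }
      where
      same : ∀ {x} (q : head x ≡ head x) → _≡_ {A = In D (head x)} (x , q) (x , refl)
      same refl = refl

    indep⇒free : ∀ {X} → ⊕Indep D M X → ∀ x → X x → ¬ cl (X ⊖ x) x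
    indep⇒free {X} i x Xx c = C.indep⇒free (head x) (i (head x)) (x , refl) Xx
      (C.cl-mono (head x) (λ { (y , q) (Xy , ne) → Xy , λ { refl → ne refl } }) c)

-- Webs: edges with adjacency, targets and a closure operator

module Web
  (lem : (P : Set₁) → Dec P) {A V : Set} (head : A → V)
  (_⟶_ : A → A → Set) (T : Pred A 0ℓ)
  (⟶-resp : ∀ {x y f} → head x ≡ head y → x ⟶ f → y ⟶ f)
  (T-resp : ∀ {x y} → head x ≡ head y → T x → T y)
  (T-stop : ∀ {x f} → T x → ¬ (x ⟶ f))
  (cl : Pred A 0ℓ → Pred A 0ℓ)
  (cl-mono : ∀ {X Y e} → (∀ x → X x → Y x) → cl X e → cl Y e)
  (cl-ext : ∀ {X e} → X e → cl X e)
  (cl-trans : ∀ {X Y e} → (∀ y → Y y → cl X y) → cl Y e → cl X e)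
  (cl-exch : ∀ {X f e} → cl (X ⊕ f) e → ¬ cl X e → cl (X ⊕ e) f)
  (cl-local : ∀ {X e} → cl X e → cl (λ x → X x × head x ≡ head e) e)
  (cl-fin : ∀ {X e} → cl X e → Σ (List A) λ I → (∀ x → x ∈ˡ I → X x) × cl (toSet I) e)
  (enum : ℕ → Maybe A)
  (enum-hits : ∀ a n → Σ ℕ λ m → n ≤ m × enum m ≡ just a)
  where
  open Classical lem

  Free : Pred A 0ℓ → Set
  Free X = ∀ x → X x → ¬ cl (X ⊖ x) x

  -- By `cl-local`, only elements with the head of `e` can make the difference. Equality of heads
  -- then lets walks that leave `e` be restarted at `d`.
  cl-diff : ∀ {X Z e} → cl X e → ¬ cl Z e → Σ A λ d → X d × head d ≡ head e × ¬ Z d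
  cl-diff {X} {Z} {e} c ¬c = dne λ none →
    ¬c (cl-mono (λ { x (Xx , q) → dne λ ¬Z → none (x , Xx , q , ¬Z) }) (cl-local c))

  free-mono : ∀ {X Y} → (∀ x → X x → Y x) → Free Y → Free X
  free-mono h fr x Xx c = fr x (h x Xx) (cl-mono (λ { y (Xy , ne) → h y Xy , ne }) c)

  free-add : ∀ {X e} → Free X → ¬ cl X e → Free (X ⊕ e)
  free-add {X} {e} fr ¬c x (inj₂ refl) c =
    ¬c (cl-mono (λ { y (inj₁ a , ne) → a ; y (inj₂ q , ne) → ⊥-elim (ne q) }) c)
  free-add {X} {e} fr ¬c x (inj₁ Xx) c =
    ¬c (cl-mono (λ { y (inj₁ (Xy , _)) → Xy ; y (inj₂ refl) → Xx })
          (cl-exch (cl-mono (λ { y (inj₁ a , ne) → inj₁ (a , ne) ; y (inj₂ q , ne) → inj₂ q }) c) (fr x Xx)))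

  free-mem : ∀ {X Z x} → Free X → (∀ y → Z y → X y) → X x → cl Z x → Z x
  free-mem {Z = Z} {x} fr Z≤ Xx c = dne λ ¬Z →
    fr x Xx (cl-mono (λ y Zy → Z≤ y Zy , λ { refl → ¬Z Zy }) c)

  -- `d` lies on the fundamental circuit of `e` in `X`. A finite witness is added to `Z` one element
  -- at a time. The element that first makes `e` spanned is exchangeable with `e`, so if the rest of
  -- `X` spanned `e`, it would span that element too.
  critical : ∀ {X Z e} → Free X → (∀ y → Z y → X y) → cl X e → ¬ cl Z e →
             Σ A λ d → X d × ¬ Z d × ¬ cl (X ⊖ d) e
  critical {X} {Z} {e} fr Z≤ c ¬c with cl-fin c
  ... | I , I≤ , cI = go I Z Z≤ I≤ (cl-mono (λ x → inj₂) cI) ¬c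
    where
    go : ∀ I Z → (∀ y → Z y → X y) → (∀ y → y ∈ˡ I → X y) → cl (Z ∪ᵖ toSet I) e → ¬ cl Z e →
         Σ A λ d → X d × ¬ Z d × ¬ cl (X ⊖ d) e
    go [] Z Z≤ I≤ c ¬c = ⊥-elim (¬c (cl-mono (λ { x (inj₁ a) → a }) c))
    go (i ∷ I) Z Z≤ I≤ c ¬c with dec (cl (Z ⊕ i) e)
    ... | yes ci = i , I≤ i (here refl) , ¬Zi , λ c′ → fr i (I≤ i (here refl))
            (cl-trans (λ { y (inj₁ Zy) → cl-ext (Z≤ y Zy , λ { refl → ¬Zi Zy }) ; y (inj₂ refl) → c′ })
               (cl-exch ci ¬c))
      where
      ¬Zi : ¬ Z i
      ¬Zi Zi = ¬c (cl-mono (λ { y (inj₁ a) → a ; y (inj₂ refl) → Zi }) ci)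
    ... | no ¬ci with go I (Z ⊕ i) (λ { y (inj₁ a) → Z≤ y a ; y (inj₂ refl) → I≤ y (here refl) })
                       (λ y m → I≤ y (there m))
                       (cl-mono (λ { y (inj₁ a) → inj₁ (inj₁ a) ; y (inj₂ (here q)) → inj₁ (inj₂ q)
                                   ; y (inj₂ (there m)) → inj₂ m }) c) ¬ci
    ... | d , Xd , ¬Z , cd = d , Xd , (λ Zd → ¬Z (inj₁ Zd)) , cd

  -- Escapes, states, links and waves

  data Esc (Z : Pred A 0ℓ) : A → Set where
    stop : ∀ {e} → T e → Esc Z e
    step : ∀ {e f} → e ⟶ f → ¬ cl Z f → Esc Z f → Esc Z e

  -- The starting edge itself may be spanned by `Z`; only what follows its head is constrained.
  esc-resp : ∀ {Z x y} → head x ≡ head y → Esc Z x → Esc Z y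
  esc-resp q (stop t)     = stop (T-resp q t)
  esc-resp q (step a n e) = step (⟶-resp q a) n e

  esc-anti : ∀ {Y Z x} → (∀ y → Y y → Z y) → Esc Z x → Esc Y x
  esc-anti h (stop t)     = stop t
  esc-anti h (step a n e) = step a (λ c → n (cl-mono h c)) (esc-anti h e)

  -- X collects every edge fixed so far; S ⊆ X are the last edges of the paths still to be continued.
  record State : Set₁ where
    field
      X S  : Pred A 0ℓ
      free : Free X
      S⊑X  : ∀ x → S x → X x
  open State public

  -- A path is traced backwards along `p`. Being inductive, a trail meets `S` after finitely many
  -- steps, and it survives when `N` grows and `p` keeps its old values.
  data Trail (S N : Pred A 0ℓ) (p : A → A) : A → Set where
    base : ∀ {f} → S f → Trail S N p f
    next : ∀ {f} → N f → p f ⟶ f → Trail S N p (p f) → Trail S N p f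

  data Root (N : Pred A 0ℓ) (p : A → A) (b : A) : A → Set where
    self : Root N p b b
    next : ∀ {f} → N f → Root N p b (p f) → Root N p b f

  -- Every path of σ is continued, ended or discarded; N holds the new edges and
  -- p the predecessor of a new edge on its path.
  record Link (σ τ : State) : Set₁ where
    field
      N      : Pred A 0ℓ
      p      : A → A
      X⊑     : ∀ x → X σ x → X τ x
      N⊑     : ∀ x → N x → X τ x
      new    : ∀ x → N x → ¬ X σ x
      inj    : ∀ x y → N x → N y → p x ≡ p y → x ≡ y
      wf     : ∀ x → N x → Trail (S σ) N p x
      ends   : ∀ x → S τ x → S σ x ⊎ N x
      nosucc : ∀ x → N x → ¬ S τ (p x)
  open Link public

  RootOf : ∀ {σ τ} → Link σ τ → A → A → Set
  RootOf ℓ = Root (N ℓ) (p ℓ)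

  Total : ∀ {σ τ} → Link σ τ → Set
  Total {σ} {τ} ℓ = ∀ s → S σ s → Σ A λ l → S τ l × RootOf ℓ s l

  K : State → Pred A 0ℓ
  K σ = X σ ∖ᵖ S σ

  -- `S τ` together with `Z` separates from t all other used edges, abandoned segments included. `Z`
  -- holds edges spent earlier: they help to span the cut but need not be sealed themselves.
  Seals : Pred A 0ℓ → State → Set
  Seals Z τ = ∀ x → X τ x → ¬ S τ x → ¬ Z x → ¬ Esc (Z ∪ᵖ S τ) x

  Wave : State → State → Set₁
  Wave σ τ = Σ (Link σ τ) λ _ → Seals (K σ) τ

  Misses : ∀ {σ τ} → Link σ τ → A → Set
  Misses {τ = τ} ℓ b = ∀ l → S τ l → ¬ RootOf ℓ b l

  Hindered : State → Set₁
  Hindered σ = Σ State λ τ → Σ (Wave σ τ) λ w → Σ A λ b → S σ b × Misses (proj₁ w) b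

  trail-next : ∀ {σ τ} (ℓ : Link σ τ) {x} → N ℓ x → (p ℓ x ⟶ x) × Trail (S σ) (N ℓ) (p ℓ) (p ℓ x)
  trail-next {σ} ℓ {x} Nx with wf ℓ x Nx
  ... | base s      = ⊥-elim (new ℓ x Nx (S⊑X σ x s))
  ... | next _ a tr = a , tr

  trail-ends : ∀ {S N p x} → Trail S N p x → S x ⊎ N x
  trail-ends (base s)     = inj₁ s
  trail-ends (next n _ _) = inj₂ n

  pred-ends : ∀ {σ τ} (ℓ : Link σ τ) {x} → N ℓ x → S σ (p ℓ x) ⊎ N ℓ (p ℓ x)
  pred-ends ℓ Nx = trail-ends (proj₂ (trail-next ℓ Nx))

  pred-X : ∀ {σ τ} (ℓ : Link σ τ) {x} → N ℓ x → X τ (p ℓ x)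
  pred-X {σ} ℓ Nx with pred-ends ℓ Nx
  ... | inj₁ s = X⊑ ℓ _ (S⊑X σ _ s)
  ... | inj₂ n = N⊑ ℓ _ n

  root-trans : ∀ {N p a b c} → Root N p a b → Root N p b c → Root N p a c
  root-trans r self       = r
  root-trans r (next n s) = next n (root-trans r s)

  root-mono : ∀ {N N′ : Pred A 0ℓ} {p p′ a b} → (∀ x → N x → N′ x) → (∀ x → N x → p′ x ≡ p x) →
              Root N p a b → Root N′ p′ a b
  root-mono h q self = self
  root-mono {N′ = N′} {p′ = p′} h q (next n r) =
    next (h _ n) (subst (Root N′ p′ _) (sym (q _ n)) (root-mono h q r))

  trail-mono : ∀ {S N N′ : Pred A 0ℓ} {p p′ b} → (∀ x → N x → N′ x) → (∀ x → N x → p′ x ≡ p x) →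
               Trail S N p b → Trail S N′ p′ b
  trail-mono h q (base s) = base s
  trail-mono {S} {N′ = N′} {p′ = p′} h q (next n a r) =
    next (h _ n) (subst (_⟶ _) (sym (q _ n)) a) (subst (Trail S N′ p′) (sym (q _ n)) (trail-mono h q r))

  Injective : Pred A 0ℓ → (A → A) → Set
  Injective N p = ∀ x y → N x → N y → p x ≡ p y → x ≡ y

  root-first : ∀ {N p u y} → Root N p u y → u ≡ y ⊎ Σ A λ v → N v × p v ≡ u × Root N p v y
  root-first self = inj₁ refl
  root-first {y = y} (next n r) with root-first r
  ... | inj₁ refl                  = inj₂ (y , n , refl , self)
  ... | inj₂ (v , Nv , q , r′) = inj₂ (v , Nv , q , next n r′)

  -- Injectivity gives each edge at most one successor, so what lies below `s` is a chain.
  root-comparable : ∀ {N p s x y} → Injective N p → Root N p s x → Root N p s y →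
                    Root N p x y ⊎ Root N p y x
  root-comparable i self r = inj₁ r
  root-comparable i (next n r) r′ with root-comparable i r r′
  ... | inj₂ h = inj₂ (next n h)
  ... | inj₁ h with root-first h
  ... | inj₁ refl = inj₂ (next n self)
  ... | inj₂ (v , Nv , q , h′) with i _ _ n Nv (sym q)
  ... | refl = inj₁ h′

  root-last : ∀ {N : Pred A 0ℓ} {p u y} → (∀ x → N x → p x ≢ u) → Root N p u y → u ≡ y
  root-last no-succ r with root-first r
  ... | inj₁ q                = q
  ... | inj₂ (v , Nv , q , _) = ⊥-elim (no-succ v Nv q)

  last≢ : ∀ {σ τ} (ℓ : Link σ τ) {l} → S τ l → ∀ x → N ℓ x → p ℓ x ≢ l
  last≢ ℓ Sl x Nx refl = nosucc ℓ x Nx Sl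

  id-link : ∀ {σ τ} → (∀ x → X σ x → X τ x) → (∀ x → S τ x → S σ x) → Link σ τ
  id-link h k = record
    { N = λ _ → ⊥ ; p = λ x → x ; X⊑ = h ; N⊑ = λ x () ; new = λ x () ; inj = λ x y ()
    ; wf = λ x () ; ends = λ x s → inj₁ (k x s) ; nosucc = λ x () }

  -- Link composition

  module Compose {σ τ υ} (ℓ₁ : Link σ τ) (ℓ₂ : Link τ υ) where
    pc : A → A
    pc x with dec (N ℓ₁ x)
    ... | yes _ = p ℓ₁ x
    ... | no  _ = p ℓ₂ x

    pc₁ : ∀ x → N ℓ₁ x → pc x ≡ p ℓ₁ x
    pc₁ x n with dec (N ℓ₁ x)
    ... | yes _ = refl
    ... | no ¬n = ⊥-elim (¬n n)

    disjoint : ∀ x → N ℓ₂ x → ¬ N ℓ₁ x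
    disjoint x n₂ n₁ = new ℓ₂ x n₂ (N⊑ ℓ₁ x n₁)

    pc₂ : ∀ x → N ℓ₂ x → pc x ≡ p ℓ₂ x
    pc₂ x n with dec (N ℓ₁ x)
    ... | yes n₁ = ⊥-elim (disjoint x n n₁)
    ... | no  _  = refl

    Nc : Pred A 0ℓ
    Nc = N ℓ₁ ∪ᵖ N ℓ₂

    -- A first-phase predecessor lies in `X τ` but is not a last edge of `τ`; a second-phase one is
    -- a last edge of `τ` or new after `τ`.
    pred≢ : ∀ x y → N ℓ₁ x → N ℓ₂ y → p ℓ₁ x ≢ p ℓ₂ y
    pred≢ x y n₁ n₂ q with pred-ends ℓ₂ n₂
    ... | inj₁ s = nosucc ℓ₁ x n₁ (subst (S τ) (sym q) s)
    ... | inj₂ n = new ℓ₂ _ n (subst (X τ) q (pred-X ℓ₁ n₁))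

    injc : Injective Nc pc
    injc x y (inj₁ a) (inj₁ b) q = inj ℓ₁ x y a b (trans (sym (pc₁ x a)) (trans q (pc₁ y b)))
    injc x y (inj₁ a) (inj₂ b) q = ⊥-elim (pred≢ x y a b (trans (sym (pc₁ x a)) (trans q (pc₂ y b))))
    injc x y (inj₂ a) (inj₁ b) q = ⊥-elim (pred≢ y x b a (trans (sym (pc₁ y b)) (trans (sym q) (pc₂ x a))))
    injc x y (inj₂ a) (inj₂ b) q = inj ℓ₂ x y a b (trans (sym (pc₂ x a)) (trans q (pc₂ y b)))

    lift₁ : ∀ {x} → Trail (S σ) (N ℓ₁) (p ℓ₁) x → Trail (S σ) Nc pc x
    lift₁ = trail-mono (λ x → inj₁) pc₁

    lift₂ : ∀ {x} → Trail (S τ) (N ℓ₂) (p ℓ₂) x → Trail (S σ) Nc pc x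
    lift₂ (base {f} s) with ends ℓ₁ f s
    ... | inj₁ s′ = base s′
    ... | inj₂ n  = lift₁ (wf ℓ₁ f n)
    lift₂ (next {f} n a tr) = next (inj₂ n) (subst (_⟶ f) (sym (pc₂ f n)) a)
                              (subst (Trail (S σ) Nc pc) (sym (pc₂ f n)) (lift₂ tr))

    endsc : ∀ x → S υ x → S σ x ⊎ Nc x
    endsc x s with ends ℓ₂ x s
    ... | inj₂ n = inj₂ (inj₂ n)
    ... | inj₁ s′ with ends ℓ₁ x s′
    ... | inj₁ s″ = inj₁ s″
    ... | inj₂ n  = inj₂ (inj₁ n)

    nosuccc : ∀ x → Nc x → ¬ S υ (pc x)
    nosuccc x (inj₂ n) s = nosucc ℓ₂ x n (subst (S υ) (pc₂ x n) s)
    nosuccc x (inj₁ n) s with ends ℓ₂ _ (subst (S υ) (pc₁ x n) s)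
    ... | inj₁ s′ = nosucc ℓ₁ x n s′
    ... | inj₂ n′ = new ℓ₂ _ n′ (pred-X ℓ₁ n)

    link : Link σ υ
    link = record
      { N = Nc ; p = pc
      ; X⊑ = λ x a → X⊑ ℓ₂ x (X⊑ ℓ₁ x a)
      ; N⊑ = λ { x (inj₁ n) → X⊑ ℓ₂ x (N⊑ ℓ₁ x n) ; x (inj₂ n) → N⊑ ℓ₂ x n }
      ; new = λ { x (inj₁ n) → new ℓ₁ x n ; x (inj₂ n) a → new ℓ₂ x n (X⊑ ℓ₁ x a) }
      ; inj = injc
      ; wf = λ { x (inj₁ n) → lift₁ (wf ℓ₁ x n) ; x (inj₂ n) → lift₂ (wf ℓ₂ x n) }
      ; ends = endsc ; nosucc = nosuccc }

    root₁ : ∀ {a b} → RootOf ℓ₁ a b → RootOf link a b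
    root₁ = root-mono (λ x → inj₁) pc₁

    root₂ : ∀ {a b} → RootOf ℓ₂ a b → RootOf link a b
    root₂ = root-mono (λ x → inj₂) pc₂

    -- This and the next two lemmas split a composite path at its last edge in `τ`: no first-phase
    -- edge follows it and no second-phase edge precedes it.
    root-upper : ∀ {a b} → S τ a ⊎ N ℓ₂ a → RootOf link a b → (S τ b ⊎ N ℓ₂ b) × RootOf ℓ₂ a b
    root-upper h self = h , self
    root-upper h (next {f} n r) with root-upper h r
    root-upper h (next {f} (inj₂ n) r) | _ , r′ =
      inj₂ n , next n (subst (RootOf ℓ₂ _) (pc₂ f n) r′)
    root-upper h (next {f} (inj₁ n) r) | inj₁ s , _ = ⊥-elim (nosucc ℓ₁ f n (subst (S τ) (pc₁ f n) s))
    root-upper h (next {f} (inj₁ n) r) | inj₂ m , _ =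
      ⊥-elim (new ℓ₂ _ m (subst (X τ) (sym (pc₁ f n)) (pred-X ℓ₁ n)))

    root-lower : ∀ {a b} → X τ b → RootOf link a b → RootOf ℓ₁ a b
    root-lower Xb self = self
    root-lower Xb (next {f} (inj₂ n) r) = ⊥-elim (new ℓ₂ f n Xb)
    root-lower Xb (next {f} (inj₁ n) r) =
      next n (subst (RootOf ℓ₁ _) (pc₁ f n) (root-lower (subst (X τ) (sym (pc₁ f n)) (pred-X ℓ₁ n)) r))

    root-through : ∀ {s l} → X σ s → S τ l ⊎ N ℓ₂ l → RootOf link s l →
                   Σ A λ m → S τ m × RootOf ℓ₁ s m × RootOf ℓ₂ m l
    root-through {l = l} Xs (inj₁ Sl) r = l , Sl , root-lower (S⊑X τ l Sl) r , self
    root-through Xs (inj₂ n) self = ⊥-elim (new ℓ₂ _ n (X⊑ ℓ₁ _ Xs))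
    root-through Xs (inj₂ n) (next {f} _ r)
      with root-through Xs (subst (λ y → S τ y ⊎ N ℓ₂ y) (sym (pc₂ f n)) (pred-ends ℓ₂ n)) r
    ... | m , Sm , r₁ , r₂ = m , Sm , r₁ , next n (subst (RootOf ℓ₂ m) (pc₂ f n) r₂)

  open Compose public using () renaming (link to _⊚_)

  ⊚-total : ∀ {σ τ υ} (ℓ₁ : Link σ τ) (ℓ₂ : Link τ υ) → Total ℓ₁ → Total ℓ₂ → Total (ℓ₁ ⊚ ℓ₂)
  ⊚-total ℓ₁ ℓ₂ t₁ t₂ s Ss with t₁ s Ss
  ... | m , Sm , r₁ with t₂ m Sm
  ... | l , Sl , r₂ = l , Sl , root-trans (Compose.root₁ ℓ₁ ℓ₂ r₁) (Compose.root₂ ℓ₁ ℓ₂ r₂)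

  -- An escape past `Z` and `S τ` is shown, from its end backwards, to pass both given barriers too.
  -- An edge spanned by one of them would share its head with some `d` outside `Z` and `S τ`, which
  -- is sealed by the first hypothesis if it is spent in `σ` and by the second otherwise.
  seals-⊚ : ∀ {Z σ τ} → (∀ x → X σ x → X τ x) → Seals Z σ → Seals (K σ) τ → Seals Z τ
  seals-⊚ {Z} {σ} {τ} h s₁ s₂ x Xx ¬Sx ¬Zx e = clash (both e) Xx ¬Zx ¬Sx refl
    where
    Both : A → Set
    Both e = Esc (K σ ∪ᵖ S τ) e × Esc (Z ∪ᵖ S σ) e
    clash : ∀ {e d} → Both e → X τ d → ¬ Z d → ¬ S τ d → head d ≡ head e → ⊥
    clash {e} {d} (β , γ) Xd ¬Zd ¬Sd q with dec (K σ d)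
    ... | yes (Xσ , ¬Sσ) = s₁ d Xσ ¬Sσ ¬Zd (esc-resp (sym q) γ)
    ... | no ¬K          = s₂ d Xd ¬Sd ¬K (esc-resp (sym q) β)
    both : ∀ {e} → Esc (Z ∪ᵖ S τ) e → Both e
    both (stop t) = stop t , stop t
    both (step {f = f} a n e) = step a β (proj₁ ih) , step a γ (proj₂ ih)
      where
      ih = both e
      β : ¬ cl (K σ ∪ᵖ S τ) f
      β c with cl-diff c n
      ... | d , inj₁ (Xd , _) , q , ¬d = clash ih (h d Xd) (λ z → ¬d (inj₁ z)) (λ s → ¬d (inj₂ s)) q
      ... | d , inj₂ s , q , ¬d        = ¬d (inj₂ s)
      γ : ¬ cl (Z ∪ᵖ S σ) f
      γ c with cl-diff c n
      ... | d , inj₁ z , q , ¬d = ¬d (inj₁ z)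
      ... | d , inj₂ s , q , ¬d = clash ih (h d (S⊑X σ d s)) (λ z → ¬d (inj₁ z)) (λ s → ¬d (inj₂ s)) q

  wave-⊚ : ∀ {σ τ υ} → Wave σ τ → Wave τ υ → Wave σ υ
  wave-⊚ {σ} {τ} {υ} (ℓ₁ , s₁) (ℓ₂ , s₂) = ℓ₁ ⊚ ℓ₂ , seals-⊚ {K σ} {τ} {υ} (X⊑ ℓ₂) s₁ s₂

  trail-root : ∀ {S N : Pred A 0ℓ} {p x} → Trail S N p x → Σ A λ s → S s × Root N p s x
  trail-root (base s) = _ , s , self
  trail-root (next n _ t) with trail-root t
  ... | s , Ss , r = s , Ss , next n r

  end-root : ∀ {σ τ} (ℓ : Link σ τ) {x} → S σ x ⊎ N ℓ x → Σ A λ s → S σ s × RootOf ℓ s x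
  end-root ℓ (inj₁ s) = _ , s , self
  end-root ℓ (inj₂ n) = trail-root (wf ℓ _ n)

  last-unique : ∀ {σ τ} (ℓ : Link σ τ) {s x y} → S τ x → S τ y → RootOf ℓ s x → RootOf ℓ s y → x ≡ y
  last-unique ℓ Sx Sy r r′ with root-comparable (inj ℓ) r r′
  ... | inj₁ q = root-last (last≢ ℓ Sx) q
  ... | inj₂ q = sym (root-last (last≢ ℓ Sy) q)

  -- The start `s` of the path to `b` is abandoned: an end of the composite path from `s` would lie
  -- below a last edge of `τ`, and by `last-unique` that edge is `b`.
  hindered-⊚ : ∀ {σ τ} → Wave σ τ → Hindered τ → Hindered σ
  hindered-⊚ {σ} {τ} w₁@(ℓ₁ , _) (υ , w₂@(ℓ₂ , _) , b , Sb , miss) with end-root ℓ₁ (ends ℓ₁ b Sb)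
  ... | s , Ss , rs = υ , wave-⊚ w₁ w₂ , s , Ss , miss′
    where
    miss′ : Misses (ℓ₁ ⊚ ℓ₂) s
    miss′ l Sl r with Compose.root-through ℓ₁ ℓ₂ (S⊑X σ s Ss) (ends ℓ₂ l Sl) r
    ... | m , Sm , r₁ , r₂ = miss l Sl (subst (λ y → RootOf ℓ₂ y l) (last-unique ℓ₁ Sm Sb r₁ rs) r₂)

  unhindered-total : ∀ {σ τ} → ¬ Hindered σ → (w : Wave σ τ) → Total (proj₁ w)
  unhindered-total {τ = τ} ¬h w s Ss = dne λ none →
    ¬h (τ , w , s , Ss , λ l Sl r → none (l , Sl , r))

  link-drop : ∀ {σ τ} → Link σ τ → ∀ x → X σ x → ¬ S σ x → ¬ S τ x
  link-drop ℓ x Xx ¬S S′ with ends ℓ x S′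
  ... | inj₁ s = ¬S s
  ... | inj₂ n = new ℓ x n Xx

  -- Limits of chains of links

  record Extends {o σ τ} (ℓ : Link o σ) (ℓ′ : Link o τ) : Set where
    field
      N-mono : ∀ x → N ℓ x → N ℓ′ x
      p-same : ∀ x → N ℓ x → p ℓ′ x ≡ p ℓ x
  open Extends

  ⊚-extends : ∀ {σ τ υ} (ℓ₁ : Link σ τ) (ℓ₂ : Link τ υ) → Extends ℓ₁ (ℓ₁ ⊚ ℓ₂)
  ⊚-extends ℓ₁ ℓ₂ = record { N-mono = λ x → inj₁ ; p-same = Compose.pc₁ ℓ₁ ℓ₂ }

  Eventually : (ℕ → Set) → Set
  Eventually P = Σ ℕ λ n → ∀ m → n ≤ m → P m

  mono-steps : (P : ℕ → Set) → (∀ i → P i → P (suc i)) → ∀ {i} j → i ≤ j → P i → P j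
  mono-steps P h {i} j i≤j Pi with m≤n⇒m<n∨m≡n i≤j
  ... | inj₂ refl = Pi
  mono-steps P h (suc j) i≤j Pi | inj₁ (s≤s i≤j′) = h j (mono-steps P h j i≤j′ Pi)

  module Limit (σ : ℕ → State) (τ : State)
    (X-mono : ∀ i x → X (σ i) x → X (σ (suc i)) x)
    (S-drop : ∀ i x → X (σ i) x → ¬ S (σ i) x → ¬ S (σ (suc i)) x)
    (X↑ : ∀ i x → X (σ i) x → X τ x) (X↓ : ∀ x → X τ x → Σ ℕ λ i → X (σ i) x)
    (S↑ : ∀ x → Eventually (λ i → S (σ i) x) → S τ x) (S↓ : ∀ x → S τ x → Eventually (λ i → S (σ i) x))
    where

    X-mono* : ∀ {i} j → i ≤ j → ∀ x → X (σ i) x → X (σ j) x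
    X-mono* j i≤j x = mono-steps (λ k → X (σ k) x) (λ k → X-mono k x) j i≤j

    out-mono* : ∀ {i} j → i ≤ j → ∀ x → X (σ i) x × ¬ S (σ i) x → X (σ j) x × ¬ S (σ j) x
    out-mono* j i≤j x = mono-steps (λ k → X (σ k) x × ¬ S (σ k) x)
      (λ k (a , b) → X-mono k x a , S-drop k x a b) j i≤j

    -- An edge that ceases to be last never becomes last again, so outside the lower limit `S τ` it
    -- is eventually never last.
    out : ∀ x → X τ x → ¬ S τ x → Eventually (λ i → X (σ i) x × ¬ S (σ i) x)
    out x Xx ¬S with X↓ x Xx
    ... | i , Xi with dec (Σ ℕ λ j → i ≤ j × ¬ S (σ j) x)
    ... | yes (j , i≤j , ¬Sj) = j , λ k j≤k → out-mono* k j≤k x (X-mono* j i≤j x Xi , ¬Sj)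
    ... | no none = ⊥-elim (¬S (S↑ x (i , λ j i≤j → dne λ ¬Sj → none (j , i≤j , ¬Sj))))

    module _ {o : State} (Λ : ∀ i → Link o (σ i)) (ext : ∀ i → Extends (Λ i) (Λ (suc i))) where
      N∞ : Pred A 0ℓ
      N∞ x = Σ ℕ λ i → N (Λ i) x

      p∞ : A → A
      p∞ x with dec (N∞ x)
      ... | yes (i , _) = p (Λ i) x
      ... | no _        = x

      Same : ∀ {i} j → i ≤ j → ∀ x → N (Λ i) x → N (Λ j) x × p (Λ j) x ≡ p (Λ i) x
      Same {i} j i≤j x n = mono-steps (λ k → N (Λ k) x × p (Λ k) x ≡ p (Λ i) x)
        (λ k (a , b) → N-mono (ext k) x a , trans (p-same (ext k) x a) b) j i≤j (n , refl)

      p∞-at : ∀ i x → N (Λ i) x → p∞ x ≡ p (Λ i) x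
      p∞-at i x n with dec (N∞ x)
      ... | no none = ⊥-elim (none (i , n))
      ... | yes (j , n′) with ≤-total i j
      ... | inj₁ i≤j = proj₂ (Same j i≤j x n)
      ... | inj₂ j≤i = sym (proj₂ (Same i j≤i x n′))

      inj∞ : Injective N∞ p∞
      inj∞ x y (i , n) (j , n′) q = inj (Λ k) x y (proj₁ a) (proj₁ b)
        (trans (proj₂ a) (trans (sym (p∞-at i x n)) (trans q (trans (p∞-at j y n′) (sym (proj₂ b))))))
        where
        k = i ⊔ j
        a = Same k (m≤m⊔n i j) x n
        b = Same k (m≤n⊔m i j) y n′

      limit-link : Link o τ
      limit-link = record
        { N = N∞ ; p = p∞
        ; X⊑ = λ x a → X↑ 0 x (X⊑ (Λ 0) x a)
        ; N⊑ = λ { x (i , n) → X↑ i x (N⊑ (Λ i) x n) }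
        ; new = λ { x (i , n) → new (Λ i) x n }
        ; inj = inj∞
        ; wf = λ { x (i , n) → trail-mono (λ y m → i , m) (p∞-at i) (wf (Λ i) x n) }
        ; ends = λ x s → ends∞ x (S↓ x s)
        ; nosucc = λ { x (i , n) s → nosucc∞ x i n (S↓ _ s) } }
        where
        ends∞ : ∀ x → Eventually (λ i → S (σ i) x) → S o x ⊎ N∞ x
        ends∞ x (i , h) with ends (Λ i) x (h i ≤-refl)
        ... | inj₁ s = inj₁ s
        ... | inj₂ n = inj₂ (i , n)
        nosucc∞ : ∀ x i → N (Λ i) x → ¬ Eventually (λ j → S (σ j) (p∞ x))
        nosucc∞ x i n (j , h) with Same (i ⊔ j) (m≤m⊔n i j) x n
        ... | n′ , q = nosucc (Λ (i ⊔ j)) x n′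
          (subst (S (σ (i ⊔ j))) (p∞-at (i ⊔ j) x n′) (h (i ⊔ j) (m≤n⊔m i j)))

      limit-root : ∀ i {a b} → RootOf (Λ i) a b → RootOf limit-link a b
      limit-root i = root-mono (λ x n → i , n) (p∞-at i)

    module _ (Z : ℕ → Pred A 0ℓ) (Z∞ : Pred A 0ℓ) (Z⊑ : ∀ i x → Z i x → Z∞ x)
             (Z⊑X : ∀ x → Z∞ x → X τ x) (seals : ∀ i → Seals (Z i) (σ i)) where

      -- An edge outside the closure of the limit set is outside the closure of X τ ⊖ d for some d that
      -- is missing from the limit, hence from almost all of the sets.
      esc-eventually : ∀ {e} → Esc (Z∞ ∪ᵖ S τ) e → Eventually (λ i → Esc (Z i ∪ᵖ S (σ i)) e)
      esc-eventually (stop t) = 0 , λ _ _ → stop t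
      esc-eventually (step {f = f} a n e) with esc-eventually e | avoid
        where
        avoid : Eventually (λ i → ¬ cl (Z i ∪ᵖ S (σ i)) f)
        avoid with dec (cl (X τ) f)
        ... | no ¬c = 0 , λ i _ c → ¬c (cl-mono
                (λ { x (inj₁ z) → Z⊑X x (Z⊑ i x z) ; x (inj₂ s) → X↑ i x (S⊑X (σ i) x s) }) c)
        ... | yes c with critical (free τ) (λ { x (inj₁ z) → Z⊑X x z ; x (inj₂ s) → S⊑X τ x s }) c n
        ... | d , Xd , ¬d , crit with out d Xd (λ s → ¬d (inj₂ s))
        ... | j , h = j , λ i j≤i ci → crit (cl-mono
                (λ { x (inj₁ z) → Z⊑X x (Z⊑ i x z) , λ { refl → ¬d (inj₁ (Z⊑ i x z)) }
                   ; x (inj₂ s) → X↑ i x (S⊑X (σ i) x s) , λ { refl → proj₂ (h i j≤i) s } }) ci)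
      ... | i , h | j , k = i ⊔ j , λ m le →
        step a (k m (≤-trans (m≤n⊔m i j) le)) (h m (≤-trans (m≤m⊔n i j) le))

      limit-seals : Seals Z∞ τ
      limit-seals x Xx ¬S ¬Z e with esc-eventually e | out x Xx ¬S
      ... | i , h | j , k = seals (i ⊔ j) x (proj₁ (k _ (m≤n⊔m i j))) (proj₂ (k _ (m≤n⊔m i j)))
        (λ z → ¬Z (Z⊑ _ x z)) (h _ (m≤m⊔n i j))

  -- A dependence has a finite witness, which already lies in some `Xs n`.
  free-union : (Xs : ℕ → Pred A 0ℓ) → (∀ i x → Xs i x → Xs (suc i) x) → (∀ i → Free (Xs i)) →
               Free (λ x → Σ ℕ λ i → Xs i x)
  free-union Xs mono fr x (i , Xx) c with cl-fin c
  ... | I , I≤ , cI with bound I (λ y m → proj₁ (I≤ y m))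
    where
    bound : ∀ I → (∀ y → y ∈ˡ I → Σ ℕ λ j → Xs j y) → Σ ℕ λ n → i ≤ n × (∀ y → y ∈ˡ I → Xs n y)
    bound [] h = i , ≤-refl , λ y ()
    bound (y ∷ I) h with bound I (λ z m → h z (there m)) | h y (here refl)
    ... | n , i≤n , k | j , Xy = n ⊔ j , ≤-trans i≤n (m≤m⊔n n j) , λ
      { z (here refl) → mono-steps (λ l → Xs l z) (λ l → mono l z) (n ⊔ j) (m≤n⊔m n j) Xy
      ; z (there m)   → mono-steps (λ l → Xs l z) (λ l → mono l z) (n ⊔ j) (m≤m⊔n n j) (k z m) }
  ... | n , i≤n , k = fr n x (mono-steps (λ l → Xs l x) (λ l → mono l x) n i≤n Xx)
      (cl-mono (λ y m → k y m , proj₂ (I≤ y m)) cI)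

  basis : (P : Pred A 0ℓ) → Σ (Pred A 0ℓ) λ B → Free B × (∀ x → B x → P x) × (∀ e → P e → cl B e)
  basis P = B , free-union Bs mono (λ i → proj₁ (proj₂ (greedy i)))
          , (λ x (i , Bx) → proj₂ (proj₂ (greedy i)) x Bx) , spans
    where
    Partial : Set₁
    Partial = Σ (Pred A 0ℓ) λ B → Free B × (∀ x → B x → P x)
    add : Maybe A → Partial → Partial
    add nothing b = b
    add (just e) (B , fr , B≤) with dec (P e × ¬ cl B e)
    ... | yes (Pe , ¬c) = B ⊕ e , free-add fr ¬c , λ { x (inj₁ Bx) → B≤ x Bx ; x (inj₂ refl) → Pe }
    ... | no _          = B , fr , B≤
    greedy : ℕ → Partial
    greedy zero    = (λ _ → ⊥) , (λ x ()) , λ x ()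
    greedy (suc i) = add (enum i) (greedy i)
    Bs : ℕ → Pred A 0ℓ
    Bs i = proj₁ (greedy i)
    B : Pred A 0ℓ
    B x = Σ ℕ λ i → Bs i x
    add-mono : ∀ m b x → proj₁ b x → proj₁ (add m b) x
    add-mono nothing b x Bx = Bx
    add-mono (just e) (B , fr , B≤) x Bx with dec (P e × ¬ cl B e)
    ... | yes _ = inj₁ Bx
    ... | no _  = Bx
    mono : ∀ i x → Bs i x → Bs (suc i) x
    mono i = add-mono (enum i) (greedy i)
    add-spans : ∀ e b → P e → cl (proj₁ (add (just e) b)) e
    add-spans e (B , fr , B≤) Pe with dec (P e × ¬ cl B e)
    ... | yes _  = cl-ext (inj₂ refl)
    ... | no none = dne λ ¬c → none (Pe , ¬c)
    spans : ∀ e → P e → cl B e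
    spans e Pe with enum-hits e 0
    ... | m , _ , q = cl-mono (λ x Bx → suc m , Bx)
      (subst (λ k → cl (proj₁ (add k (greedy m))) e) (sym q) (add-spans e (greedy m) Pe))

  lim : (σ : ℕ → State) → (∀ i x → X (σ i) x → X (σ (suc i)) x) → State
  lim σ mono = record
    { X = λ x → Σ ℕ λ i → X (σ i) x ; S = λ x → Eventually (λ i → S (σ i) x)
    ; free = free-union (λ i → X (σ i)) mono (λ i → free (σ i))
    ; S⊑X = λ x (n , h) → n , S⊑X (σ n) x (h n ≤-refl) }

  -- Augmenting walks

  -- For free `U`, `c` is on the fundamental circuit of `f`, so `U ⊖ c ⊕ f` spans the same edges as
  -- `U`. If `f` is in `U`, this degenerates to `f ≡ c`.
  Swap : Pred A 0ℓ → A → A → Set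
  Swap U c f = cl U f × ¬ cl (U ⊖ c) f

  swap-mem : ∀ {U c f} → Swap U c f → U c × head c ≡ head f
  swap-mem (cf , ¬cf) with cl-diff cf ¬cf
  ... | d , Ud , q , ¬d with dne (λ ne → ¬d (Ud , ne))
  ... | refl = Ud , q

  swap-back : ∀ {U c f} → Swap U c f → cl (U ⊖ c ⊕ f) c
  swap-back {U} {c} (cf , ¬cf) = cl-exch (cl-mono split cf) ¬cf
    where
    split : ∀ x → U x → (U ⊖ c ⊕ c) x
    split x Ux with dec (x ≡ c)
    ... | yes q = inj₂ q
    ... | no ne = inj₁ (Ux , ne)

  swap-same : ∀ {U c f} → Swap U c f → U f → f ≡ c
  swap-same (cf , ¬cf) Uf = dne λ ne → ¬cf (cl-ext (Uf , ne))

  root-inv : ∀ {N p a y} → Root N p a y → a ≡ y ⊎ (N y × Root N p a (p y))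
  root-inv self       = inj₁ refl
  root-inv (next n r) = inj₂ (n , r)

  -- A cycle through `x` also passes through its predecessor, and so on back to `S`, which contains
  -- no new edge.
  root-acyclic : ∀ {S N : Pred A 0ℓ} {p x} → (∀ y → S y → ¬ N y) → Trail S N p x → N x → ¬ Root N p x (p x)
  root-acyclic d (base s) n r = d _ s n
  root-acyclic {N = N} {p} d (next _ _ t) n r with root-inv r
  ... | inj₁ q = root-acyclic d t (subst N q n) (subst (Root N p (p _)) (cong p q) self)
  ... | inj₂ (n′ , r′) = root-acyclic d t n′ (root-trans (next n self) r′)

  module Augment (σ : State) (z : A) (Cov : Pred A 0ℓ) where

    Sealed : A → Set
    Sealed e = ¬ Esc Cov e

    -- A system of paths from S σ whose end b is to be continued; edges of U outside X σ and Q are debris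
    -- of abandoned path segments.
    record Flow : Set₁ where
      field
        U Q L  : Pred A 0ℓ
        π      : A → A
        b      : A
        U-free : Free U
        z∉U    : ¬ cl U z
        X⊑U    : ∀ x → X σ x → U x
        N⊑U    : ∀ x → Q x → U x
        N-new  : ∀ x → Q x → ¬ X σ x
        N-inj  : Injective Q π
        N-wf   : ∀ x → Q x → Trail (S σ) Q π x
        L-ends : ∀ x → L x → S σ x ⊎ Q x
        L-last : ∀ x → Q x → ¬ L (π x)
        b-end  : S σ b ⊎ Q b
        b∉L    : ¬ L b
        b-last : ∀ x → Q x → π x ≢ b
        sealed : ∀ x → U x → ¬ K σ x → ¬ L x → Sealed x
        cover  : ∀ x → cl Cov x → cl (U ⊕ z) x

      L⊑U : ∀ x → L x → U x
      L⊑U x l with L-ends x l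
      ... | inj₁ s = X⊑U x (S⊑X σ x s)
      ... | inj₂ n = N⊑U x n

      b-U : U b
      b-U with b-end
      ... | inj₁ s = X⊑U b (S⊑X σ b s)
      ... | inj₂ n = N⊑U b n

      N-disj : ∀ y → S σ y → ¬ Q y
      N-disj y s n = N-new y n (S⊑X σ y s)

      b-sealed : Sealed b
      b-sealed = sealed b b-U (λ k → notK b-end k) b∉L
        where
        notK : S σ b ⊎ Q b → ¬ K σ b
        notK (inj₁ s) (_ , ¬s) = ¬s s
        notK (inj₂ n) (x , _)  = N-new b n x

      b-trail : Trail (S σ) Q π b
      b-trail with b-end
      ... | inj₁ s = base s
      ... | inj₂ n = N-wf b n

      N-next : ∀ {x} → Q x → (π x ⟶ x) × Trail (S σ) Q π (π x)
      N-next {x} n with N-wf x n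
      ... | base s     = ⊥-elim (N-disj x s n)
      ... | next _ a t = a , t

      p-U : ∀ {x} → Q x → U (π x)
      p-U n with trail-ends (proj₂ (N-next n))
      ... | inj₁ s = X⊑U _ (S⊑X σ _ s)
      ... | inj₂ m = N⊑U _ m

    -- AP Φ e n: the goal can be reached from e with n exchanges; shortening a path is free of charge.
    data AP (Φ : Flow) : A → ℕ → Set where
      done : ∀ {e f} → e ⟶ f → ¬ cl (Flow.U Φ) f → cl (Flow.U Φ ⊕ z) f → AP Φ e 0
      up   : ∀ {e n} → Flow.Q Φ e → AP Φ (Flow.π Φ e) n → AP Φ e n
      swap : ∀ {e f c n} → e ⟶ f → Flow.Q Φ c → Swap (Flow.U Φ) c f → AP Φ (Flow.π Φ c) n → AP Φ e (suc n)
      jump : ∀ {e f n} → e ⟶ f → ¬ cl (Flow.U Φ ⊕ z) f → AP Φ f n → AP Φ e (suc n)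

    ap-root : ∀ Φ {e x n} → Root (Flow.Q Φ) (Flow.π Φ) e x → AP Φ e n → AP Φ x n
    ap-root Φ self       ap = ap
    ap-root Φ (next m r) ap = up m (ap-root Φ r ap)

    Result : Set₁
    Result = Σ State λ τ → Wave σ τ × cl (X τ) z

    module Attach (Φ : Flow) {f : A} (arc : Flow.b Φ ⟶ f) (f∉U : ¬ Flow.U Φ f) where
      open Flow Φ

      p′ : A → A
      p′ x with dec (x ≡ f)
      ... | yes _ = b
      ... | no _  = π x

      p′-f : p′ f ≡ b
      p′-f with dec (f ≡ f)
      ... | yes _ = refl
      ... | no ne = ⊥-elim (ne refl)

      p′-N : ∀ x → Q x → p′ x ≡ π x
      p′-N x n with dec (x ≡ f)
      ... | yes refl = ⊥-elim (f∉U (N⊑U f n))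
      ... | no _     = refl

      p′-inj : Injective (Q ⊕ f) p′
      p′-inj x y (inj₁ n) (inj₁ m) q = N-inj x y n m (trans (sym (p′-N x n)) (trans q (p′-N y m)))
      p′-inj x y (inj₁ n) (inj₂ refl) q = ⊥-elim (b-last x n (trans (sym (p′-N x n)) (trans q p′-f)))
      p′-inj x y (inj₂ refl) (inj₁ m) q = ⊥-elim (b-last y m (trans (sym (p′-N y m)) (trans (sym q) p′-f)))
      p′-inj x y (inj₂ refl) (inj₂ refl) q = refl

      trail′ : ∀ {x} → Trail (S σ) Q π x → Trail (S σ) (Q ⊕ f) p′ x
      trail′ = trail-mono (λ x → inj₁) p′-N

      wf′ : ∀ x → (Q ⊕ f) x → Trail (S σ) (Q ⊕ f) p′ x
      wf′ x (inj₁ n) = trail′ (N-wf x n)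
      wf′ x (inj₂ refl) = next (inj₂ refl) (subst (_⟶ f) (sym p′-f) arc)
                            (subst (Trail (S σ) (Q ⊕ f) p′) (sym p′-f) (trail′ b-trail))

      new′ : ∀ x → (Q ⊕ f) x → ¬ X σ x
      new′ x (inj₁ n)    = N-new x n
      new′ x (inj₂ refl) = λ a → f∉U (X⊑U x a)

      N⊑U′ : ∀ x → (Q ⊕ f) x → (U ⊕ f) x
      N⊑U′ x (inj₁ n) = inj₁ (N⊑U x n)
      N⊑U′ x (inj₂ q) = inj₂ q

      p′-≢f : ∀ x → (Q ⊕ f) x → p′ x ≢ f
      p′-≢f x (inj₁ n) q    = f∉U (subst U (trans (sym (p′-N x n)) q) (p-U n))
      p′-≢f x (inj₂ refl) q = f∉U (subst U (trans (sym p′-f) q) b-U)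

      p′-∉L : ∀ x → (Q ⊕ f) x → ¬ L (p′ x)
      p′-∉L x (inj₁ n) l    = L-last x n (subst L (p′-N x n) l)
      p′-∉L x (inj₂ refl) l = b∉L (subst L p′-f l)

    -- `f` is exchangeable with `z`, so `U ⊕ f` spans `z` and, by `cover`, everything that `Cov`
    -- spans.
    finish : ∀ Φ {f} → Flow.b Φ ⟶ f → ¬ cl (Flow.U Φ) f → cl (Flow.U Φ ⊕ z) f → Result
    finish Φ {f} arc ¬c c = τ , (ℓ , seals) , z∈
      where
      open Flow Φ
      open Attach Φ arc (λ u → ¬c (cl-ext u))
      z∈ : cl (U ⊕ f) z
      z∈ = cl-exch c ¬c
      τ : State
      τ = record { X = U ⊕ f ; S = L ⊕ f ; free = free-add U-free ¬c
                 ; S⊑X = λ { x (inj₁ l) → inj₁ (L⊑U x l) ; x (inj₂ q) → inj₂ q } }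
      ℓ : Link σ τ
      ℓ = record
        { N = Q ⊕ f ; p = p′ ; X⊑ = λ x a → inj₁ (X⊑U x a) ; N⊑ = N⊑U′ ; new = new′ ; inj = p′-inj ; wf = wf′
        ; ends = λ { x (inj₁ l) → map₂ inj₁ (L-ends x l) ; x (inj₂ q) → inj₂ (inj₂ q) }
        ; nosucc = λ { x n (inj₁ l) → p′-∉L x n l ; x n (inj₂ q) → p′-≢f x n q } }
      -- An edge of the escape outside `cl Cov` prolongs an escape past `Cov`; one inside shares its
      -- head with a sealed edge of `U`, where the argument restarts.
      still : ∀ {e} → Esc (K σ ∪ᵖ S τ) e → ∀ x → head x ≡ head e → ¬ Sealed x
      still (stop t) x q sx = sx (stop (T-resp (sym q) t))
      still (step {f = g} a n e) x q sx with dec (cl Cov g)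
      ... | no ¬cov = still e g refl λ eg → sx (step (⟶-resp (sym q) a) ¬cov eg)
      ... | yes cov with cl-diff {U ⊕ f} (cl-trans (λ { y (inj₁ u) → cl-ext (inj₁ u) ; y (inj₂ refl) → z∈ }) (cover g cov)) n
      ... | d , inj₂ q′ , _ , ¬d  = ¬d (inj₂ (inj₂ q′))
      ... | d , inj₁ Ud , q′ , ¬d =
        still e d q′ (sealed d Ud (λ k → ¬d (inj₁ k)) (λ l → ¬d (inj₂ (inj₁ l))))
      seals : Seals (K σ) τ
      seals x (inj₂ q) ¬S ¬K e = ¬S (inj₂ q)
      seals x (inj₁ u) ¬S ¬K e = still e x refl (sealed x u ¬K (λ l → ¬S (inj₁ l)))

    -- The removed edge stays in `U` as debris: it is already sealed, and keeping it preserves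
    -- `cover`.
    cut : ∀ Φ → Flow.Q Φ (Flow.b Φ) → Flow
    cut Φ nb = record
      { U = U ; Q = Q ⊖ b ; L = L ; π = π ; b = π b ; U-free = U-free ; z∉U = z∉U ; X⊑U = X⊑U
      ; N⊑U = λ x (n , _) → N⊑U x n ; N-new = λ x (n , _) → N-new x n
      ; N-inj = λ x y (n , _) (m , _) → N-inj x y n m
      ; N-wf = λ x (n , ne) → trim ne (N-wf x n)
      ; L-ends = λ x l → map₂ (λ n → n , λ { refl → b∉L l }) (L-ends x l)
      ; L-last = λ x (n , _) → L-last x n
      ; b-end = trail-ends (trim (b-last b nb) (proj₂ (N-next nb)))
      ; b∉L = L-last b nb
      ; b-last = λ x (n , ne) q → ne (N-inj x b n nb q)
      ; sealed = sealed ; cover = cover }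
      where
      open Flow Φ
      trim : ∀ {x} → x ≢ b → Trail (S σ) Q π x → Trail (S σ) (Q ⊖ b) π x
      trim ne (base s)     = base s
      trim ne (next n a t) = next (n , ne) a (trim (b-last _ n) t)

    -- By `cover`, `f` is outside `cl Cov`, so it inherits the sealing of `b`. If `U ⊕ f` spanned
    -- `z`, exchange would put `f` into `cl (U ⊕ z)`.
    grow : ∀ Φ {f} → Flow.b Φ ⟶ f → ¬ cl (Flow.U Φ ⊕ z) f → Flow
    grow Φ {f} arc ¬c = record
      { U = U ⊕ f ; Q = Q ⊕ f ; L = L ; π = p′ ; b = f
      ; U-free = free-add U-free ¬cU
      ; z∉U = λ c → ¬c (cl-exch c z∉U)
      ; X⊑U = λ x a → inj₁ (X⊑U x a) ; N⊑U = N⊑U′ ; N-new = new′ ; N-inj = p′-inj ; N-wf = wf′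
      ; L-ends = λ x l → map₂ inj₁ (L-ends x l)
      ; L-last = p′-∉L ; b-end = inj₂ (inj₂ refl) ; b∉L = λ l → f∉U (L⊑U f l) ; b-last = p′-≢f
      ; sealed = λ { x (inj₁ u) → sealed x u ; x (inj₂ refl) _ _ e →
          b-sealed (step arc (λ c → ¬c (cover x c)) e) }
      ; cover = λ x c → cl-mono (λ { y (inj₁ u) → inj₁ (inj₁ u) ; y (inj₂ q) → inj₂ q }) (cover x c) }
      where
      open Flow Φ
      ¬cU : ¬ cl U f
      ¬cU c = ¬c (cl-mono (λ x → inj₁) c)
      f∉U : ¬ U f
      f∉U u = ¬cU (cl-ext u)
      open Attach Φ arc f∉U

    -- As `c` and `f` share their head, `f` is hung below `b` and takes over the continuation of
    -- `c`; the path through `c` is cut back to `π c`, the new open end. The case `f ≡ c` is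
    -- included. `¬r` prevents the rerouted path from closing into a cycle.
    module Exchange (Φ : Flow) {f c : A} (arc : Flow.b Φ ⟶ f) (Qc : Flow.Q Φ c)
                    (sw : Swap (Flow.U Φ) c f) (¬r : ¬ Root (Flow.Q Φ) (Flow.π Φ) c (Flow.b Φ)) where
      open Flow Φ

      U′ Q′ L′ : Pred A 0ℓ
      U′ = U ⊖ c ⊕ f
      Q′ = Q ⊖ c ⊕ f
      L′ x = (L x × x ≢ c) ⊎ (L c × x ≡ f)

      hc : head c ≡ head f
      hc = proj₂ (swap-mem sw)

      N≢f : ∀ x → U x → x ≢ c → x ≢ f
      N≢f x u ne refl = ne (swap-same sw u)

      p′ : A → A
      p′ x with dec (x ≡ f) | dec (π x ≡ c)
      ... | yes _ | _     = b
      ... | no _  | yes _ = f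
      ... | no _  | no _  = π x

      p′-f : ∀ {x} → x ≡ f → p′ x ≡ b
      p′-f {x} q with dec (x ≡ f) | dec (π x ≡ c)
      ... | yes _ | _ = refl
      ... | no ne | _ = ⊥-elim (ne q)

      p′-c : ∀ {x} → x ≢ f → π x ≡ c → p′ x ≡ f
      p′-c {x} ne q with dec (x ≡ f) | dec (π x ≡ c)
      ... | yes r | _     = ⊥-elim (ne r)
      ... | no _  | yes _ = refl
      ... | no _  | no ¬q = ⊥-elim (¬q q)

      p′-o : ∀ {x} → x ≢ f → π x ≢ c → p′ x ≡ π x
      p′-o {x} ne nq with dec (x ≡ f) | dec (π x ≡ c)
      ... | yes r | _     = ⊥-elim (ne r)
      ... | no _  | yes q = ⊥-elim (nq q)
      ... | no _  | no _  = refl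

      f≢b : f ≢ b
      f≢b refl with swap-same sw b-U
      ... | refl = ¬r self

      f≢p : ∀ {x} → Q x → π x ≢ c → f ≢ π x
      f≢p n ne refl = ne (swap-same sw (p-U n))

      old : ∀ {x} → Q x → x ≢ c → x ≢ f
      old n = N≢f _ (N⊑U _ n)

      cl-U : ∀ {x} → cl U x → cl U′ x
      cl-U = cl-trans λ y Uy → keep y Uy
        where
        keep : ∀ y → U y → cl U′ y
        keep y Uy with dec (y ≡ c)
        ... | yes refl = swap-back sw
        ... | no ne    = cl-ext (inj₁ (Uy , ne))

      cl-U⁻ : ∀ {x} → cl U′ x → cl U x
      cl-U⁻ = cl-trans λ { y (inj₁ (u , _)) → cl-ext u ; y (inj₂ refl) → proj₁ sw }

      cl-Uz : ∀ {x} → cl (U ⊕ z) x → cl (U′ ⊕ z) x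
      cl-Uz = cl-trans λ { y (inj₁ u) → cl-mono (λ x → inj₁) (cl-U (cl-ext u)) ; y (inj₂ q) → cl-ext (inj₂ q) }

      cl-Uz⁻ : ∀ {x} → cl (U′ ⊕ z) x → cl (U ⊕ z) x
      cl-Uz⁻ = cl-trans λ { y (inj₁ u) → cl-mono (λ x → inj₁) (cl-U⁻ (cl-ext u)) ; y (inj₂ q) → cl-ext (inj₂ q) }

      -- The path ending in b does not use c, so it survives and f hangs below it.
      trail-b : ∀ {x} → Trail (S σ) Q π x → ¬ Root Q π c x → Trail (S σ) Q′ p′ x
      trail-b (base s) ¬r = base s
      trail-b (next {x} n a t) ¬r = next (inj₁ (n , ne))
          (subst (_⟶ x) (sym eq) a) (subst (Trail (S σ) Q′ p′) (sym eq) (trail-b t (λ r → ¬r (next n r))))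
        where
        ne : x ≢ c
        ne refl = ¬r self
        eq : p′ x ≡ π x
        eq = p′-o (old n ne) (λ q → ¬r (next n (subst (Root Q π c) (sym q) self)))

      trail-f : Trail (S σ) Q′ p′ f
      trail-f = next (inj₂ refl) (subst (_⟶ f) (sym (p′-f refl)) arc)
                  (subst (Trail (S σ) Q′ p′) (sym (p′-f refl)) (trail-b b-trail ¬r))

      p′-old : ∀ {x} → Q x → x ≢ c → (π x ≡ c × p′ x ≡ f) ⊎ (π x ≢ c × p′ x ≡ π x)
      p′-old {x} n ne = cases (dec (π x ≡ c))
        where
        cases : Dec (π x ≡ c) → (π x ≡ c × p′ x ≡ f) ⊎ (π x ≢ c × p′ x ≡ π x)
        cases (yes a) = inj₁ (a , p′-c (old n ne) a)
        cases (no a)  = inj₂ (a , p′-o (old n ne) a)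

      trail′ : ∀ {x} → x ≢ c → Trail (S σ) Q π x → Trail (S σ) Q′ p′ x
      trail′ ne (base s) = base s
      trail′ ne (next {x} n a t) with p′-old n ne
      ... | inj₁ (q , r) = next (inj₁ (n , ne))
                             (subst (_⟶ x) (sym r) (⟶-resp (trans (cong head q) hc) a))
                             (subst (Trail (S σ) Q′ p′) (sym r) trail-f)
      ... | inj₂ (q , r) = next (inj₁ (n , ne)) (subst (_⟶ x) (sym r) a)
                             (subst (Trail (S σ) Q′ p′) (sym r) (trail′ q t))

      pc≢c : π c ≢ c
      pc≢c q = root-acyclic N-disj (N-wf c Qc) Qc (subst (Root Q π c) (sym q) self)

      p′≢b : ∀ x → Q x → x ≢ c → p′ x ≢ b
      p′≢b x n ne q with p′-old n ne
      ... | inj₁ (a , r) = f≢b (trans (sym r) q)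
      ... | inj₂ (a , r) = b-last x n (trans (sym r) q)

      inj-old : ∀ x y → Q x → Q y → x ≢ c → y ≢ c → p′ x ≡ p′ y → x ≡ y
      inj-old x y n m nx ny q with p′-old n nx | p′-old m ny
      ... | inj₁ (a , _) | inj₁ (d , _) = N-inj x y n m (trans a (sym d))
      ... | inj₂ (_ , r) | inj₂ (_ , s) = N-inj x y n m (trans (sym r) (trans q s))
      ... | inj₁ (_ , r) | inj₂ (d , s) = ⊥-elim (f≢p m d (trans (sym r) (trans q s)))
      ... | inj₂ (a , r) | inj₁ (_ , s) = ⊥-elim (f≢p n a (trans (sym s) (trans (sym q) r)))

      inj′ : Injective Q′ p′
      inj′ x y (inj₁ (n , nx)) (inj₁ (m , ny)) q = inj-old x y n m nx ny q
      inj′ x y (inj₁ (n , nx)) (inj₂ refl) q = ⊥-elim (p′≢b x n nx (trans q (p′-f refl)))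
      inj′ x y (inj₂ refl) (inj₁ (m , ny)) q = ⊥-elim (p′≢b y m ny (trans (sym q) (p′-f refl)))
      inj′ x y (inj₂ refl) (inj₂ refl) q = refl

      L∌f : ¬ (L f × f ≢ c)
      L∌f (l , ne) = ne (swap-same sw (L⊑U f l))

      last′ : ∀ x → Q′ x → ¬ L′ (p′ x)
      last′ x (inj₂ refl) (inj₁ (l , _)) = b∉L (subst L (p′-f refl) l)
      last′ x (inj₂ refl) (inj₂ (_ , q)) = f≢b (sym (trans (sym (p′-f refl)) q))
      last′ x (inj₁ (n , ne)) l with p′-old n ne
      last′ x (inj₁ (n , ne)) (inj₁ l)        | inj₁ (_ , r) = L∌f (subst (λ y → L y × y ≢ c) r l)
      last′ x (inj₁ (n , ne)) (inj₂ (Lc , _)) | inj₁ (a , _) = L-last x n (subst L (sym a) Lc)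
      last′ x (inj₁ (n , ne)) (inj₁ (l , _))  | inj₂ (_ , r) = L-last x n (subst L r l)
      last′ x (inj₁ (n , ne)) (inj₂ (_ , q))  | inj₂ (a , r) = f≢p n a (trans (sym q) r)

      pred-last : ∀ x → Q′ x → p′ x ≢ π c
      pred-last x (inj₂ refl) q = b-last c Qc (sym (trans (sym (p′-f refl)) q))
      pred-last x (inj₁ (n , ne)) q with p′-old n ne
      ... | inj₁ (_ , r) = f≢p Qc pc≢c (trans (sym r) q)
      ... | inj₂ (_ , r) = ne (N-inj x c n Qc (trans (sym r) q))

      X∌f : ¬ X σ f
      X∌f a with swap-same sw (X⊑U f a)
      ... | refl = N-new f Qc a

      flow : Flow
      flow = record
        { U = U′ ; Q = Q′ ; L = L′ ; π = p′ ; b = π c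
        ; U-free = free-add (free-mono (λ x → proj₁) U-free) (proj₂ sw)
        ; z∉U = λ d → z∉U (cl-U⁻ d)
        ; X⊑U = λ x a → inj₁ (X⊑U x a , λ { refl → N-new x Qc a })
        ; N⊑U = λ { x (inj₁ (n , ne)) → inj₁ (N⊑U x n , ne) ; x (inj₂ q) → inj₂ q }
        ; N-new = λ { x (inj₁ (n , _)) → N-new x n ; x (inj₂ refl) → X∌f }
        ; N-inj = inj′
        ; N-wf = λ { x (inj₁ (n , ne)) → trail′ ne (N-wf x n) ; x (inj₂ refl) → trail-f }
        ; L-ends = λ { x (inj₁ (l , ne)) → map₂ (λ n → inj₁ (n , ne)) (L-ends x l)
                     ; x (inj₂ (_ , q)) → inj₂ (inj₂ q) }
        ; L-last = last′
        ; b-end = map₂ (λ n → inj₁ (n , pc≢c)) (trail-ends (proj₂ (N-next Qc)))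
        ; b∉L = λ { (inj₁ (l , _)) → L-last c Qc l ; (inj₂ (_ , q)) → f≢p Qc pc≢c (sym q) }
        ; b-last = pred-last
        ; sealed = λ { x (inj₁ (u , ne)) ¬k ¬l → sealed x u ¬k (λ l → ¬l (inj₁ (l , ne)))
                     ; x (inj₂ refl) ¬k ¬l e → sealed c (N⊑U c Qc) (λ k → N-new c Qc (proj₁ k))
                         (λ l → ¬l (inj₂ (l , refl))) (esc-resp (sym hc) e) }
        ; cover = λ x d → cl-Uz (cover x d) }

    module _ (Φ : Flow) (nb : Flow.Q Φ (Flow.b Φ)) {n : ℕ}
             (min : ∀ m → m < n → ¬ AP Φ (Flow.b Φ) m) where
      open Flow Φ

      -- Coming back to `b`, or exchanging it, after some exchange would yield a shorter walk from
      -- `b`. Before the first exchange the walk only climbs from `π b`, where acyclicity excludes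
      -- `b`; this is the `Root` alternative.
      cut-ap : ∀ {e m} → m ≤ n → m < n ⊎ Root Q π e (π b) → AP Φ e m → AP (cut Φ nb) e m
      cut-ap le h (done a c d) = done a c d
      cut-ap {e} {m} le h (up q ap) with dec (e ≡ b)
      ... | no ne = up (q , ne) (cut-ap le (map₂ (root-trans (next q self)) h) ap)
      cut-ap le (inj₁ lt) (up q ap) | yes refl = ⊥-elim (min _ lt (up q ap))
      cut-ap le (inj₂ r) (up q ap)  | yes refl = ⊥-elim (root-acyclic N-disj (N-wf b nb) nb r)
      cut-ap le h (swap {c = c} a q sw ap) with dec (c ≡ b)
      ... | yes refl = ⊥-elim (min _ le (up nb ap))
      ... | no ne    = swap a (q , ne) sw (cut-ap (≤-trans (n≤1+n _) le) (inj₁ le) ap)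
      cut-ap le h (jump a c ap) = jump a c (cut-ap (≤-trans (n≤1+n _) le) (inj₁ le) ap)

      uncut : ∀ {e m} → AP (cut Φ nb) e m → AP Φ e m
      uncut (done a c d)          = done a c d
      uncut (up (q , _) ap)       = up q (uncut ap)
      uncut (swap a (q , _) s ap) = swap a q s (uncut ap)
      uncut (jump a c ap)         = jump a c (uncut ap)

    module _ (Φ : Flow) {f c n} (arc : Flow.b Φ ⟶ f) (Qc : Flow.Q Φ c) (sw : Swap (Flow.U Φ) c f)
             (¬r : ¬ Root (Flow.Q Φ) (Flow.π Φ) c (Flow.b Φ))
             (min : ∀ m → m < suc n → ¬ AP Φ (Flow.b Φ) m) where
      open Flow Φ
      open Exchange Φ arc Qc sw ¬r

      Image : A → A → Set
      Image e e′ = (e ≡ c × e′ ≡ f) ⊎ (e ≢ c × e′ ≡ e)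

      image-head : ∀ {e e′} → Image e e′ → head e ≡ head e′
      image-head (inj₁ (refl , refl)) = hc
      image-head (inj₂ (_ , refl))    = refl

      no-shortcut : ∀ {d m} → Q d → AP Φ (π d) m → m < n → ¬ Swap U d f
      no-shortcut Qd ap lt sw′ = min _ (s≤s lt) (swap arc Qd sw′ ap)

      -- In a shortest walk no `d` exchanged later lies on the circuit of `f`, so the remaining
      -- swaps in `U` are still swaps in `U′`. `Image` accounts for `f` standing in for `c`.
      exchange-ap : ∀ {e e′ m} → Image e e′ → m ≤ n → m < n ⊎ Root Q π e (π c) → AP Φ e m → AP flow e′ m
      exchange-ap im le h (done a ¬d d) = done (⟶-resp (image-head im) a) (λ x → ¬d (cl-U⁻ x)) (cl-Uz d)
      exchange-ap (inj₁ (refl , _)) le (inj₁ lt) (up q ap) = ⊥-elim (no-shortcut q ap lt sw)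
      exchange-ap (inj₁ (refl , _)) le (inj₂ r) (up q ap)  =
        ⊥-elim (root-acyclic N-disj (N-wf c Qc) Qc r)
      exchange-ap (inj₂ (ne , refl)) le h (up q ap) =
        up (inj₁ (q , ne)) (exchange-ap (p′-old q ne) le (map₂ (root-trans (next q self)) h) ap)
      exchange-ap im le h (swap {f = g} {c = d} a q sw′ ap) =
        swap (⟶-resp (image-head im) a) (inj₁ (q , d≢c)) (cl-U (proj₁ sw′) , crit)
          (exchange-ap (p′-old q d≢c) (≤-trans (n≤1+n _) le) (inj₁ le) ap)
        where
        ¬sw : ¬ Swap U d f
        ¬sw = no-shortcut q ap le
        d≢c : d ≢ c
        d≢c refl = ¬sw sw
        crit : ¬ cl (U′ ⊖ d) g
        crit x = proj₂ sw′ (cl-trans (λ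
          { y (inj₁ (u , _) , ne) → cl-ext (u , ne)
          ; y (inj₂ refl , _) → dne λ ¬x → ¬sw (proj₁ sw , ¬x) }) x)
      exchange-ap im le h (jump {f = g} a ¬d ap) =
        jump (⟶-resp (image-head im) a) (λ x → ¬d (cl-Uz⁻ x))
          (exchange-ap (inj₂ ((λ { refl → ¬d (cl-ext (inj₁ (N⊑U c Qc))) }) , refl))
            (≤-trans (n≤1+n _) le) (inj₁ le) ap)

    module _ (Φ : Flow) {f n} (arc : Flow.b Φ ⟶ f) (¬c : ¬ cl (Flow.U Φ ⊕ z) f)
             (min : ∀ m → m < suc n → ¬ AP Φ (Flow.b Φ) m) where
      open Flow Φ
      open Attach Φ arc (λ u → ¬c (cl-ext (inj₁ u)))

      ap-resp : ∀ {x y m} → ¬ Q x → head x ≡ head y → AP Φ x m → AP Φ y m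
      ap-resp ¬Q h (done a c d)    = done (⟶-resp h a) c d
      ap-resp ¬Q h (up q ap)       = ⊥-elim (¬Q q)
      ap-resp ¬Q h (swap a q s ap) = swap (⟶-resp h a) q s ap
      ap-resp ¬Q h (jump a c ap)   = jump (⟶-resp h a) c ap

      -- Exchange settles `done` and `swap`, as `f` is outside `cl (U ⊕ z)`. If `f` spoils a later
      -- jump to `g`, both share their head, and jumping to `f` and continuing as from `g` is
      -- shorter.
      grow-ap : ∀ {e m} → m ≤ n → AP Φ e m → AP (grow Φ arc ¬c) e m
      grow-ap le (done a ¬d d) = done a
        (λ x → ¬c (cl-trans (λ { y (inj₁ u) → cl-ext (inj₁ u) ; y (inj₂ refl) → d }) (cl-exch x ¬d)))
        (cl-mono (λ { y (inj₁ u) → inj₁ (inj₁ u) ; y (inj₂ q) → inj₂ q }) d)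
      grow-ap le (up {e} q ap) =
        up (inj₁ q) (subst (λ y → AP (grow Φ arc ¬c) y _) (sym (p′-N e q)) (grow-ap le ap))
      grow-ap le (swap {f = g} {c = d} a q sw ap) =
        swap a (inj₁ q) (cl-mono (λ x → inj₁) (proj₁ sw) , crit)
          (subst (λ y → AP (grow Φ arc ¬c) y _) (sym (p′-N d q)) (grow-ap (≤-trans (n≤1+n _) le) ap))
        where
        crit : ¬ cl (U ⊕ f ⊖ d) g
        crit x = ¬c (cl-trans (λ { y (inj₁ (u , _)) → cl-ext (inj₁ u) ; y (inj₂ refl) → cl-mono (λ _ → inj₁) (proj₁ sw) })
          (cl-exch (cl-mono (λ { y (inj₁ u , ne) → inj₁ (u , ne) ; y (inj₂ q′ , ne) → inj₂ q′ }) x) (proj₂ sw)))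
      grow-ap le (jump {f = g} a ¬d ap) = jump a far (grow-ap (≤-trans (n≤1+n _) le) ap)
        where
        far : ¬ cl (U ⊕ f ⊕ z) g
        far x with cl-diff x ¬d
        ... | d , inj₁ (inj₁ u) , _ , ne = ne (inj₁ u)
        ... | d , inj₂ q , _ , ne        = ne (inj₂ q)
        ... | d , inj₁ (inj₂ refl) , h , _ =
          min _ (s≤s le) (jump arc ¬c (ap-resp (λ q → ¬d (cl-ext (inj₁ (N⊑U _ q)))) (sym h) ap))

    -- The trail, over an arbitrary `Q₀`, serves as a measure: it shrinks structurally at each `up`,
    -- where the number of exchanges stays the same.
    augment-min : ∀ n → (∀ {m} → m < n → ∀ Φ → AP Φ (Flow.b Φ) m → Result) →
                  ∀ Φ {Q₀} → Trail (S σ) Q₀ (Flow.π Φ) (Flow.b Φ) →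
                  (∀ m → m < n → ¬ AP Φ (Flow.b Φ) m) → AP Φ (Flow.b Φ) n → Result
    augment-min n ih Φ t min (done a ¬c c) = finish Φ a ¬c c
    augment-min n ih Φ (base s) min (up q ap) = ⊥-elim (Flow.N-disj Φ _ s q)
    augment-min n ih Φ (next _ _ t) min (up q ap) =
      augment-min n ih (cut Φ q) t (λ m lt ap′ → min m lt (up q (uncut Φ q min ap′)))
        (cut-ap Φ q min ≤-refl (inj₂ self) ap)
    augment-min (suc n) ih Φ t min (swap {c = c} a q sw ap) =
      ih (n<1+n n) (Exchange.flow Φ a q sw ¬r)
        (exchange-ap Φ a q sw ¬r min (inj₂ (Exchange.pc≢c Φ a q sw ¬r , refl)) ≤-refl (inj₂ self) ap)
      where
      -- Otherwise climbing from `b` to `c` and on to `π c` would save the exchange.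
      ¬r : ¬ Root (Flow.Q Φ) (Flow.π Φ) c (Flow.b Φ)
      ¬r r = min n (n<1+n n) (ap-root Φ r (up q ap))
    augment-min (suc n) ih Φ t min (jump a ¬c ap) =
      ih (n<1+n n) (grow Φ a ¬c) (grow-ap Φ a ¬c min ≤-refl ap)

    -- Minimality is not tracked across an exchange; a shortest walk is chosen anew for each flow.
    augment : ∀ n Φ → AP Φ (Flow.b Φ) n → Result
    augment = <-rec (λ n → ∀ Φ → AP Φ (Flow.b Φ) n → Result) least
      where
      least : ∀ n → (∀ {m} → m < n → ∀ Φ → AP Φ (Flow.b Φ) m → Result) →
              ∀ Φ → AP Φ (Flow.b Φ) n → Result
      least n ih Φ ap with dec (Σ ℕ λ m → m < n × AP Φ (Flow.b Φ) m)
      ... | yes (m , lt , ap′) = ih lt Φ ap′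
      ... | no none = augment-min n ih Φ (Flow.b-trail Φ) (λ m lt ap′ → none (m , lt , ap′)) ap

  -- Spending one more edge: still unhindered, or spanned by a wave

  _+ˢ_∣_ : (σ : State) (z : A) → ¬ cl (X σ) z → State
  σ +ˢ z ∣ z∉ = record { X = X σ ⊕ z ; S = S σ ; free = free-add (free σ) z∉ ; S⊑X = λ x s → inj₁ (S⊑X σ x s) }

  module Hindrance (σ : State) (z : A) (z∉ : ¬ cl (X σ) z) (τ : State) (ℓ : Link (σ +ˢ z ∣ z∉) τ)
    (seals : Seals (K (σ +ˢ z ∣ z∉)) τ) (b : A) (Sb : S σ b) (miss : Misses ℓ b) where

    σz = σ +ˢ z ∣ z∉
    open Augment σ z (K σz ∪ᵖ S τ)

    -- The whole abandoned path is erased, so `b` becomes the open end; the other paths of the wave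
    -- form the initial flow.
    Q₀ : Pred A 0ℓ
    Q₀ x = N ℓ x × ¬ RootOf ℓ b x

    U₀ : Pred A 0ℓ
    U₀ = X σ ∪ᵖ Q₀

    U₀⊑ : ∀ x → U₀ x → X τ x
    U₀⊑ x (inj₁ a)       = X⊑ ℓ x (inj₁ a)
    U₀⊑ x (inj₂ (n , _)) = N⊑ ℓ x n

    z∉U₀ : ¬ U₀ z
    z∉U₀ (inj₁ a)       = z∉ (cl-ext a)
    z∉U₀ (inj₂ (n , _)) = new ℓ z n (inj₂ refl)

    prune : ∀ {x} → ¬ RootOf ℓ b x → Trail (S σ) (N ℓ) (p ℓ) x → Trail (S σ) Q₀ (p ℓ) x
    prune ¬r (base s)     = base s
    prune ¬r (next n a t) = next (n , ¬r) a (prune (λ r → ¬r (next n r)) t)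

    flow : Flow
    flow = record
      { U = U₀ ; Q = Q₀ ; L = S τ ; π = p ℓ ; b = b
      ; U-free = free-mono U₀⊑ (free τ)
      ; z∉U = λ c → free τ z (X⊑ ℓ z (inj₂ refl)) (cl-mono (λ y u → U₀⊑ y u , λ { refl → z∉U₀ u }) c)
      ; X⊑U = λ x → inj₁ ; N⊑U = λ x → inj₂ ; N-new = λ x (n , _) a → new ℓ x n (inj₁ a)
      ; N-inj = λ x y (n , _) (m , _) → inj ℓ x y n m
      ; N-wf = λ x (n , ¬r) → prune ¬r (wf ℓ x n)
      ; L-ends = λ x l → map₂ (λ n → n , miss x l) (ends ℓ x l)
      ; L-last = λ x (n , _) → nosucc ℓ x n
      ; b-end = inj₁ Sb
      ; b∉L = λ l → miss b l self
      ; b-last = λ x (n , ¬r) q → ¬r (next n (subst (RootOf ℓ b) (sym q) self))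
      ; sealed = λ x u ¬k ¬l → seals x (U₀⊑ x u) ¬l
          λ { (inj₁ a , ¬s) → ¬k (a , ¬s) ; (inj₂ refl , _) → z∉U₀ u }
      ; cover = λ x → cl-mono λ
          { y (inj₁ (inj₁ a , _)) → inj₁ (inj₁ a) ; y (inj₁ (inj₂ q , _)) → inj₂ q
          ; y (inj₂ l) → inj₁ (L-in y l) } }
      where
      L-in : ∀ y → S τ y → U₀ y
      L-in y l with ends ℓ y l
      ... | inj₁ s = inj₁ (S⊑X σ y s)
      ... | inj₂ n = inj₂ (n , miss y l)

    open Flow flow hiding (b)

    data Reach : A → Set where
      start : Reach b
      up    : ∀ {e} → Q₀ e → Reach e → Reach (π e)
      swap  : ∀ {e f c} → Reach e → e ⟶ f → Q₀ c → Swap U₀ c f → Reach (π c)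
      jump  : ∀ {e f} → Reach e → e ⟶ f → ¬ cl (U₀ ⊕ z) f → Reach f

    reach-ap : ∀ {e n} → Reach e → AP flow e n → Σ ℕ λ m → AP flow b m
    reach-ap start ap          = _ , ap
    reach-ap (up q r) ap       = reach-ap r (up q ap)
    reach-ap (swap r a q s) ap = reach-ap r (swap a q s ap)
    reach-ap (jump r a c) ap   = reach-ap r (jump a c ap)

    pred-sealed : ∀ {e} → Q₀ e → Sealed (π e)
    pred-sealed {e} q = sealed (π e) (p-U q) ¬K (L-last e q)
      where
      ¬K : ¬ K σ (π e)
      ¬K (Xx , ¬s) with trail-ends (proj₂ (N-next q))
      ... | inj₁ s = ¬s s
      ... | inj₂ n = N-new (π e) n Xx

    reach-sealed : ∀ {e} → Reach e → Sealed e
    reach-sealed start          = b-sealed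
    reach-sealed (up q _)       = pred-sealed q
    reach-sealed (swap _ _ q _) = pred-sealed q
    reach-sealed (jump r a ¬c)  = λ e → reach-sealed r (step a (λ c → ¬c (cover _ c)) e)

    module Stuck (none : ∀ n → ¬ AP flow b n) where

      -- Each path is cut at its first unreachable edge. Reachability is closed under predecessors,
      -- so initial segments remain, and `b`, being reachable, is abandoned.
      Q* : Pred A 0ℓ
      Q* x = Q₀ x × Reach (π x)

      keep : ∀ {x} → Q₀ x → Reach x → Q* x
      keep q r = q , up q r

      τ* : State
      τ* = record
        { X = X σ ∪ᵖ Q* ; S = λ x → (S σ x ⊎ Q* x) × ¬ Reach x
        ; free = free-mono (λ { x (inj₁ a) → inj₁ a ; x (inj₂ (q , _)) → inj₂ q }) U-free
        ; S⊑X = λ { x (inj₁ s , _) → inj₁ (S⊑X σ x s) ; x (inj₂ q , _) → inj₂ q } }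

      trail* : ∀ {x} → Reach x → Trail (S σ) Q₀ π x → Trail (S σ) Q* π x
      trail* r (base s)     = base s
      trail* r (next q a t) = next (keep q r) a (trail* (up q r) t)

      wf* : ∀ x → Q* x → Trail (S σ) Q* π x
      wf* x (q , r) with N-next q
      ... | a , t = next (q , r) a (trail* r t)

      ℓ* : Link σ τ*
      ℓ* = record
        { N = Q* ; p = π ; X⊑ = λ x → inj₁ ; N⊑ = λ x → inj₂ ; new = λ x (q , _) → N-new x q
        ; inj = λ x y (q , _) (q′ , _) → N-inj x y q q′ ; wf = wf* ; ends = λ x → proj₁
        ; nosucc = λ x (q , r) (_ , ¬r) → ¬r r }

      -- Reachability spreads along an escape. An edge outside `cl U₀` must be a jump, as otherwise
      -- a walk would be complete. A spanned one swaps with some `d` outside the new cut, and an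
      -- unreachable `d` would be spent or a last edge of `τ*`.
      trapped : ∀ {e} → Esc (K σ ∪ᵖ S τ*) e → ∀ x → head x ≡ head e → ¬ Reach x
      trapped (stop t) x h r = reach-sealed r (stop (T-resp (sym h) t))
      trapped (step {f = f} a ¬c e) x h r with dec (cl U₀ f)
      ... | no ¬cU = trapped e f refl (jump r a′ λ cz → none _ (proj₂ (reach-ap r (done a′ ¬cU cz))))
        where a′ = ⟶-resp (sym h) a
      ... | yes cU with critical U-free (λ { y (inj₁ (Xy , _)) → inj₁ Xy ; y (inj₂ (inj₁ s , _)) → inj₁ (S⊑X σ y s)
                                           ; y (inj₂ (inj₂ (q , _) , _)) → inj₂ q }) cU ¬c
      ... | d , Ud , ¬d , crit = trapped e d (proj₂ (swap-mem (cU , crit))) (dne λ ¬r → ¬d (final Ud ¬r))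
        where
        final : U₀ d → ¬ Reach d → (K σ ∪ᵖ S τ*) d
        final (inj₂ q) ¬r = inj₂ (inj₂ (q , swap r (⟶-resp (sym h) a) q (cU , crit)) , ¬r)
        final (inj₁ Xd) ¬r with dec (S σ d)
        ... | yes s = inj₂ (inj₁ s , ¬r)
        ... | no ¬s = inj₁ (Xd , ¬s)

      hindered : Hindered σ
      hindered = τ* , (ℓ* , seals*) , b , Sb , miss*
        where
        seals* : Seals (K σ) τ*
        seals* x Xx ¬S ¬K e = trapped e x refl (dne λ ¬r → ¬S (end Xx , ¬r))
          where
          end : (X σ ∪ᵖ Q*) x → S σ x ⊎ Q* x
          end (inj₁ a) = inj₁ (dne λ ¬s → ¬K (a , ¬s))
          end (inj₂ q) = inj₂ q
        miss* : Misses ℓ* b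
        miss* l (_ , ¬r) root with root-last (λ x (q , _) → b-last x q) root
        ... | refl = ¬r start

    result : ¬ Hindered σ → Result
    result ¬h with dec (Σ ℕ λ n → AP flow b n)
    ... | yes (n , ap) = augment n flow ap
    ... | no none      = ⊥-elim (¬h (Stuck.hindered λ n ap → none (n , ap)))

  wave-or-unhindered : ∀ σ z (z∉ : ¬ cl (X σ) z) → ¬ Hindered σ →
    ¬ Hindered (σ +ˢ z ∣ z∉) ⊎ Σ State λ τ → Wave σ τ × cl (X τ) z
  wave-or-unhindered σ z z∉ ¬h with lem (Hindered (σ +ˢ z ∣ z∉))
  ... | no ¬h′ = inj₁ ¬h′
  ... | yes (τ , (ℓ , seals) , b , Sb , miss) = inj₂ (Hindrance.result σ z z∉ τ ℓ seals b Sb miss ¬h)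

  -- Exhausting the hindrances

  id-wave : ∀ σ → Wave σ σ
  id-wave σ = id-link (λ x a → a) (λ x s → s) , λ x Xx ¬S ¬K → ⊥-elim (¬K (Xx , ¬S))

  Kill : State → A → Set₁
  Kill σ b = Σ State λ τ → Σ (Wave σ τ) λ w → S σ b × Misses (proj₁ w) b

  kill : Maybe A → (σ : State) → Σ State λ τ → Wave σ τ
  kill nothing σ = σ , id-wave σ
  kill (just b) σ with lem (Kill σ b)
  ... | yes (τ , w , _) = τ , w
  ... | no _            = σ , id-wave σ

  kill-kills : ∀ σ b → Kill σ b → ¬ S (proj₁ (kill (just b) σ)) b
  kill-kills σ b k s with lem (Kill σ b)
  ... | yes (τ , w , _ , miss) = miss b s self
  ... | no none                = none k

  module Exhaust (σ₀ : State) where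
    seq : ℕ → State
    seq zero    = σ₀
    seq (suc i) = proj₁ (kill (enum i) (seq i))

    wave : ∀ i → Wave (seq i) (seq (suc i))
    wave i = proj₂ (kill (enum i) (seq i))

    chain : ∀ n i → Wave (seq n) (seq (i + n))
    chain n zero    = id-wave (seq n)
    chain n (suc i) = wave-⊚ (chain n i) (wave (i + n))

    X-mono : ∀ i x → X (seq i) x → X (seq (suc i)) x
    X-mono i = X⊑ (proj₁ (wave i))

    τ∞ : State
    τ∞ = lim seq X-mono

    module _ (n : ℕ) where
      open Limit (λ i → seq (i + n)) τ∞ (λ i → X-mono (i + n)) (λ i → link-drop (proj₁ (wave (i + n))))
        (λ i x a → i + n , a)
        (λ x (j , a) → j , mono-steps (λ k → X (seq k) x) (λ k → X-mono k x) (j + n) (m≤m+n j n) a)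
        (λ x (k , h) → k + n , λ m le →
          subst (λ j → S (seq j) x) (m∸n+n≡m (≤-trans (m≤n+m n k) le))
            (h (m ∸ n) (subst (_≤ m ∸ n) (m+n∸n≡m k n) (∸-monoˡ-≤ n le))))
        (λ x (k , h) → k , λ i le → h (i + n) (≤-trans le (m≤m+n i n)))

      -- All tails of the sequence have the same limit; `unhindered` needs the wave from a late
      -- stage.
      limit-wave : Wave (seq n) τ∞
      limit-wave = limit-link (λ i → proj₁ (chain n i))
                     (λ i → ⊚-extends (proj₁ (chain n i)) (proj₁ (wave (i + n))))
                 , limit-seals (λ _ → K (seq n)) (K (seq n)) (λ _ x k → k)
                     (λ x k → n , proj₁ k) (λ i → proj₂ (chain n i))

    -- `b` is scheduled again after it has become permanently last. At that stage the limit wave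
    -- followed by the hindering one abandons `b`, so `kill` would have removed it.
    unhindered : ¬ Hindered τ∞
    unhindered (υ , w , b , (k , h) , miss) with enum-hits b k
    ... | m , k≤m , q = dead (h (suc m) (≤-trans k≤m (n≤1+n m)))
      where
      lw = limit-wave m
      dead : ¬ S (proj₁ (kill (enum m) (seq m))) b
      dead rewrite q = kill-kills (seq m) b (υ , wave-⊚ lw w , h m k≤m , λ l Sl r →
        miss l Sl (proj₂ (Compose.root-upper (proj₁ lw) (proj₁ w) (inj₁ (k , h)) r)))

  -- Continuing one path up to T

  _+ᴱ_∣_ : (σ : State) (y : A) → X σ y → State
  σ +ᴱ y ∣ Xy = record { X = X σ ; S = S σ ⊕ y ; free = free σ
                       ; S⊑X = λ { x (inj₁ s) → S⊑X σ x s ; x (inj₂ refl) → Xy } }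

  trail-source : ∀ {S S′ N : Pred A 0ℓ} {p x} → (∀ x → S x → S′ x) → Trail S N p x → Trail S′ N p x
  trail-source h (base s)     = base (h _ s)
  trail-source h (next n a t) = next n a (trail-source h t)

  link-source : ∀ {σ σ′ τ} → (∀ x → X σ x → X σ′ x) → (∀ x → X σ′ x → X σ x) → (∀ x → S σ x → S σ′ x) →
                Link σ τ → Link σ′ τ
  link-source h k g ℓ = record
    { N = N ℓ ; p = p ℓ ; X⊑ = λ x a → X⊑ ℓ x (k x a) ; N⊑ = N⊑ ℓ ; new = λ x n a → new ℓ x n (k x a)
    ; inj = inj ℓ ; wf = λ x n → trail-source g (wf ℓ x n)
    ; ends = λ x s → map₁ (g x) (ends ℓ x s) ; nosucc = nosucc ℓ }

  passive : ∀ {σ τ} (ℓ : Link σ τ) {y} (Xy : X σ y) → ¬ S σ y → Link (σ +ᴱ y ∣ Xy) (τ +ᴱ y ∣ X⊑ ℓ y Xy)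
  passive {σ} {τ} ℓ {y} Xy ¬S = record
    { N = N ℓ ; p = p ℓ ; X⊑ = X⊑ ℓ ; N⊑ = N⊑ ℓ ; new = new ℓ ; inj = inj ℓ
    ; wf = λ x n → trail-source (λ x → inj₁) (wf ℓ x n)
    ; ends = λ { x (inj₁ s) → map₁ inj₁ (ends ℓ x s) ; x (inj₂ q) → inj₁ (inj₂ q) }
    ; nosucc = λ { x n (inj₁ s) → nosucc ℓ x n s ; x n (inj₂ q) → pred≢y x n q } }
    where
    pred≢y : ∀ x → N ℓ x → p ℓ x ≢ y
    pred≢y x n q with pred-ends ℓ n
    ... | inj₁ s = ¬S (subst (S σ) q s)
    ... | inj₂ m = new ℓ _ m (subst (X σ) (sym q) Xy)

  passive-total : ∀ {σ τ} (ℓ : Link σ τ) {y} (Xy : X σ y) (¬S : ¬ S σ y) → Total ℓ → Total (passive ℓ Xy ¬S)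
  passive-total ℓ {y} Xy ¬S t s (inj₂ refl) = y , inj₂ refl , self
  passive-total ℓ Xy ¬S t s (inj₁ Ss) with t s Ss
  ... | l , Sl , r = l , inj₁ Sl , r

  _-ᴱ_ : State → A → State
  σ -ᴱ a = record { X = X σ ; S = S σ ⊖ a ; free = free σ ; S⊑X = λ x (s , _) → S⊑X σ x s }

  -- `a` is carried along as a trivial path: as a last edge it helps to span the cut just as it did
  -- as a spent edge.
  hindered-remove : ∀ σ a → S σ a → Hindered (σ -ᴱ a) → Hindered σ
  hindered-remove σ a Sa (τ , (ℓ , seals) , b , (Sb , b≢a) , miss) =
    τ +ᴱ a ∣ X⊑ ℓ a Xa , (link-source (λ x a → a) (λ x a → a) restore (passive ℓ Xa (λ s → proj₂ s refl)) , seals′)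
      , b , Sb , miss′
    where
    Xa : X σ a
    Xa = S⊑X σ a Sa
    restore : ∀ x → (S σ ⊖ a ⊕ a) x → S σ x
    restore x (inj₁ (s , _)) = s
    restore x (inj₂ refl)    = Sa
    seals′ : Seals (K σ) (τ +ᴱ a ∣ X⊑ ℓ a Xa)
    seals′ x Xx ¬S ¬K e = seals x Xx (λ s → ¬S (inj₁ s))
      (λ { (Xx′ , ¬s) → ¬K (Xx′ , λ s → ¬s (s , λ q → ¬S (inj₂ q))) })
      (esc-anti (λ { y (inj₁ (Xy , ¬s)) → widen y Xy ¬s ; y (inj₂ s) → inj₂ (inj₁ s) }) e)
      where
      widen : ∀ y → X σ y → ¬ (S σ ⊖ a) y → (K σ ∪ᵖ (S τ ⊕ a)) y
      widen y Xy ¬s with dec (y ≡ a)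
      ... | yes q = inj₂ (inj₂ q)
      ... | no ne = inj₁ (Xy , λ s → ¬s (s , ne))
    miss′ : ∀ l → (S τ ⊕ a) l → ¬ RootOf ℓ b l
    miss′ l (inj₁ s) r = miss l s r
    miss′ l (inj₂ refl) r with root-inv r
    ... | inj₁ q       = b≢a q
    ... | inj₂ (n , _) = new ℓ l n Xa

  -- No link prolongs `y`, which ends in `T`, and no wave abandons it, since it escapes at once.
  -- Hence `y` can be taken out of the wave, and the abandoned edge is another one.
  hindered-add : ∀ σ y (Xy : X σ y) → ¬ S σ y → T y → Hindered (σ +ᴱ y ∣ Xy) → Hindered σ
  hindered-add σ y Xy ¬Sy Ty (τ , (ℓ , seals) , b , Sb , miss) =
    τ -ᴱ y , (ℓ′ , seals′) , b , Sb′ Sb , λ l (s , _) → miss l s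
    where
    τy : S τ y
    τy = dne λ ¬s → seals y (X⊑ ℓ y Xy) ¬s (λ k → proj₂ k (inj₂ refl)) (stop Ty)
    Sb′ : (S σ ⊕ y) b → S σ b
    Sb′ (inj₁ s)    = s
    Sb′ (inj₂ refl) = ⊥-elim (miss b τy self)
    trail′ : ∀ {x} → x ≢ y → Trail (S σ ⊕ y) (N ℓ) (p ℓ) x → Trail (S σ) (N ℓ) (p ℓ) x
    trail′ ne (base (inj₁ s)) = base s
    trail′ ne (base (inj₂ q)) = ⊥-elim (ne q)
    trail′ ne (next n a t)    = next n a (trail′ (λ q → T-stop Ty (subst (_⟶ _) q a)) t)
    ℓ′ : Link σ (τ -ᴱ y)
    ℓ′ = record
      { N = N ℓ ; p = p ℓ ; X⊑ = X⊑ ℓ ; N⊑ = N⊑ ℓ ; new = new ℓ ; inj = inj ℓ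
      ; wf = λ x n → trail′ (λ { refl → new ℓ x n Xy }) (wf ℓ x n)
      ; ends = λ x (s , ne) → map₁ (λ { (inj₁ s′) → s′ ; (inj₂ q) → ⊥-elim (ne q) }) (ends ℓ x s)
      ; nosucc = λ x n (s , _) → nosucc ℓ x n s }
    seals′ : Seals (K σ) (τ -ᴱ y)
    seals′ x Xx ¬S ¬K e = seals x Xx (λ s → ¬S (s , λ { refl → ¬K (Xy , ¬Sy) }))
      (λ { (Xx′ , ¬s) → ¬K (Xx′ , λ s → ¬s (inj₁ s)) })
      (esc-anti (λ { z (inj₁ (Xz , ¬s)) → inj₁ (Xz , λ s → ¬s (inj₁ s)) ; z (inj₂ s) → widen z s }) e)
      where
      widen : ∀ z → S τ z → (K σ ∪ᵖ (S τ ⊖ y)) z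
      widen z s with dec (z ≡ y)
      ... | yes refl = inj₁ (Xy , ¬Sy)
      ... | no ne    = inj₂ (s , ne)

  Reaching : State → A → Set₁
  Reaching σ a = Σ State λ τ → ¬ Hindered τ × Σ (Link σ τ) λ ℓ → Total ℓ × Σ A λ y → T y × RootOf ℓ a y

  module Tree (σ₀ : State) (¬h₀ : ¬ Hindered σ₀) (a : A) (Sa : S σ₀ a) where

    -- Y is a tree of edges reachable from a; each of its elements may serve as the end of the path through a.
    record Stage : Set₁ where
      field
        st    : State
        Y     : Pred A 0ℓ
        unh   : ¬ Hindered st
        Y⊑X   : ∀ y → Y y → X st y
        Y∌S   : ∀ y → Y y → ¬ S st y
        seals : Seals (K σ₀ ∪ᵖ Y) st
        via   : ∀ y (Yy : Y y) → Σ (Link σ₀ (st +ᴱ y ∣ Y⊑X y Yy)) λ ℓ → Total ℓ × RootOf ℓ a y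
    open Stage

    initial : Stage
    initial = record
      { st = σ₀ -ᴱ a ; Y = _≡ a ; unh = λ h → ¬h₀ (hindered-remove σ₀ a Sa h)
      ; Y⊑X = λ { y refl → S⊑X σ₀ a Sa } ; Y∌S = λ y q s → proj₂ s q
      ; seals = λ x Xx ¬S ¬Z _ → ¬Z (inj₁ (Xx , λ s → ¬S (s , λ q → ¬Z (inj₂ q))))
      ; via = λ { y refl → id-link (λ x a → a) (λ { x (inj₁ (s , _)) → s ; x (inj₂ refl) → Sa })
                         , (λ s Ss → s , total s Ss , self) , self } }
      where
      total : ∀ s → S σ₀ s → (S σ₀ ⊖ a ⊕ a) s
      total s Ss with dec (s ≡ a)
      ... | yes q = inj₂ q
      ... | no ne = inj₁ (Ss , ne)

    Adjacent : Stage → A → Set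
    Adjacent s f = Σ A λ y → Y s y × y ⟶ f

    -- A wave from an unhindered state is total, and it leaves the tree edges alone, as they are in
    -- `X` but not last; each of them stays available as an end.
    by-wave : (s : Stage) {τ : State} → Wave (st s) τ → Stage
    by-wave s {τ} w@(ℓ , sl) = record
      { st = τ ; Y = Y s ; unh = λ h → unh s (hindered-⊚ w h)
      ; Y⊑X = λ y Yy → X⊑ ℓ y (Y⊑X s y Yy)
      ; Y∌S = λ y Yy → link-drop ℓ y (Y⊑X s y Yy) (Y∌S s y Yy)
      ; seals = seals-⊚ {K σ₀ ∪ᵖ Y s} {st s} {τ} (X⊑ ℓ) (seals s) sl
      ; via = λ y Yy →
          let ℓ₁ , t , r = via s y Yy
              ℓ₂ = passive ℓ (Y⊑X s y Yy) (Y∌S s y Yy)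
          in ℓ₁ ⊚ ℓ₂ , ⊚-total ℓ₁ ℓ₂ t (passive-total ℓ (Y⊑X s y Yy) (Y∌S s y Yy) (unhindered-total (unh s) w))
           , Compose.root₁ ℓ₁ ℓ₂ r }

    by-edge : (s : Stage) (f : A) (f∉ : ¬ cl (X (st s)) f) → ¬ Hindered (st s +ˢ f ∣ f∉) → Adjacent s f → Stage
    by-edge s f f∉ ¬h (y₀ , Yy₀ , arc) = record
      { st = st′ ; Y = Y s ⊕ f ; unh = ¬h ; Y⊑X = Y⊑X′
      ; Y∌S = λ { y (inj₁ Yy) → Y∌S s y Yy ; y (inj₂ refl) s′ → X∌f (S⊑X (st s) f s′) }
      ; seals = λ { x (inj₂ q) ¬S ¬Z e → ¬Z (inj₂ (inj₂ q))
                  ; x (inj₁ Xx) ¬S ¬Z e → seals s x Xx ¬S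
                      (λ { (inj₁ k) → ¬Z (inj₁ k) ; (inj₂ Yx) → ¬Z (inj₂ (inj₁ Yx)) })
                      (esc-anti (λ { y (inj₁ (inj₁ k)) → inj₁ (inj₁ k) ; y (inj₁ (inj₂ Yy)) → inj₁ (inj₂ (inj₁ Yy))
                                   ; y (inj₂ s′) → inj₂ s′ }) e) }
      ; via = λ { y (inj₁ Yy) → keep y Yy ; y (inj₂ refl) → through } }
      where
      st′ = st s +ˢ f ∣ f∉
      X∌f : ¬ X (st s) f
      X∌f Xf = f∉ (cl-ext Xf)
      Y⊑X′ : ∀ y → (Y s ⊕ f) y → X st′ y
      Y⊑X′ y (inj₁ Yy) = inj₁ (Y⊑X s y Yy)
      Y⊑X′ y (inj₂ q)  = inj₂ q
      keep : ∀ y (Yy : Y s y) → Σ (Link σ₀ (st′ +ᴱ y ∣ inj₁ (Y⊑X s y Yy))) λ ℓ → Total ℓ × RootOf ℓ a y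
      keep y Yy = ℓ₁ ⊚ ℓ₂ , ⊚-total ℓ₁ ℓ₂ t (λ x Sx → x , Sx , self) , Compose.root₁ ℓ₁ ℓ₂ r
        where
        ℓ₁ = proj₁ (via s y Yy)
        t  = proj₁ (proj₂ (via s y Yy))
        r  = proj₂ (proj₂ (via s y Yy))
        ℓ₂ : Link (st s +ᴱ y ∣ Y⊑X s y Yy) (st′ +ᴱ y ∣ inj₁ (Y⊑X s y Yy))
        ℓ₂ = id-link (λ x → inj₁) (λ x s′ → s′)
      through : Σ (Link σ₀ (st′ +ᴱ f ∣ inj₂ refl)) λ ℓ → Total ℓ × RootOf ℓ a f
      through = ℓ₁ ⊚ ℓ₂ , ⊚-total ℓ₁ ℓ₂ t total
              , root-trans (Compose.root₁ ℓ₁ ℓ₂ r) (Compose.root₂ ℓ₁ ℓ₂ (next refl self))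
        where
        ℓ₁ = proj₁ (via s y₀ Yy₀)
        t  = proj₁ (proj₂ (via s y₀ Yy₀))
        r  = proj₂ (proj₂ (via s y₀ Yy₀))
        ℓ₂ : Link (st s +ᴱ y₀ ∣ Y⊑X s y₀ Yy₀) (st′ +ᴱ f ∣ inj₂ refl)
        ℓ₂ = record
          { N = _≡ f ; p = λ _ → y₀ ; X⊑ = λ x → inj₁ ; N⊑ = λ x → inj₂ ; new = λ { x refl → X∌f }
          ; inj = λ x y q q′ _ → trans q (sym q′)
          ; wf = λ { x refl → next refl arc (base (inj₂ refl)) }
          ; ends = λ x → map₁ inj₁
          ; nosucc = λ { x _ (inj₁ s′) → Y∌S s y₀ Yy₀ s′ ; x _ (inj₂ refl) → X∌f (Y⊑X s f Yy₀) } }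
        total : Total ℓ₂
        total x (inj₁ s′)   = x , inj₁ s′ , self
        total x (inj₂ refl) = f , inj₂ refl , next refl self

    record _↝[_]_ (s : Stage) (m : Maybe A) (s′ : Stage) : Set₁ where
      field
        link   : Link (st s) (st s′)
        Y-mono : ∀ y → Y s y → Y s′ y
        spans  : ∀ f → m ≡ just f → Adjacent s f → cl (X (st s′)) f
    open _↝[_]_

    advance : ∀ m s → Σ Stage (s ↝[ m ]_)
    advance nothing s = s , record
      { link = proj₁ (id-wave (st s)) ; Y-mono = λ y Yy → Yy ; spans = λ f () }
    advance (just f) s with dec (cl (X (st s)) f)
    ... | yes c = s , record
      { link = proj₁ (id-wave (st s)) ; Y-mono = λ y Yy → Yy ; spans = λ { g refl _ → c } }
    ... | no ¬c with dec (Adjacent s f)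
    ... | no ¬adj = s , record
      { link = proj₁ (id-wave (st s)) ; Y-mono = λ y Yy → Yy ; spans = λ { g refl adj → ⊥-elim (¬adj adj) } }
    ... | yes adj with wave-or-unhindered (st s) f ¬c (unh s)
    ... | inj₁ ¬h = by-edge s f ¬c ¬h adj , record
      { link = id-link (λ x → inj₁) (λ x s′ → s′) ; Y-mono = λ y → inj₁
      ; spans = λ { g refl _ → cl-ext (inj₂ refl) } }
    ... | inj₂ (τ , w , c) = by-wave s w , record
      { link = proj₁ w ; Y-mono = λ y Yy → Yy ; spans = λ { g refl _ → c } }

    stage : ℕ → Stage
    stage zero    = initial
    stage (suc i) = proj₁ (advance (enum i) (stage i))

    move : ∀ i → stage i ↝[ enum i ] stage (suc i)
    move i = proj₂ (advance (enum i) (stage i))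

    Λ : ∀ i → Link (σ₀ -ᴱ a) (st (stage i))
    Λ zero    = proj₁ (id-wave (σ₀ -ᴱ a))
    Λ (suc i) = Λ i ⊚ link (move i)

    τ∞ : State
    τ∞ = lim (λ i → st (stage i)) (λ i → X⊑ (link (move i)))

    open Limit (λ i → st (stage i)) τ∞ (λ i → X⊑ (link (move i))) (λ i → link-drop (link (move i)))
      (λ i x a → i , a) (λ x a → a) (λ x h → h) (λ x h → h)

    Y∞ : Pred A 0ℓ
    Y∞ y = Σ ℕ λ i → Y (stage i) y

    -- `f` is scheduled again after `y` has joined the tree, and is spanned from then on.
    adjacent-spanned : ∀ {y f} → Y∞ y → y ⟶ f → cl (X τ∞) f
    adjacent-spanned {y} {f} (i , Yy) arc with enum-hits f i
    ... | m , i≤m , q = cl-mono (λ x a → suc m , a) (spans (move m) f q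
      (y , mono-steps (λ j → Y (stage j) y) (λ j → Y-mono (move j) y) m i≤m Yy , arc))

    module Closed (none : ∀ y → Y∞ y → ¬ T y) where

      seals∞ : Seals (K σ₀ ∪ᵖ Y∞) τ∞
      seals∞ = limit-seals (λ i → K σ₀ ∪ᵖ Y (stage i)) (K σ₀ ∪ᵖ Y∞)
        (λ { i x (inj₁ k) → inj₁ k ; i x (inj₂ y) → inj₂ (i , y) })
        (λ { x (inj₁ (Xx , _)) → 0 , Xx ; x (inj₂ (i , Yx)) → i , Y⊑X (stage i) x Yx })
        (λ i → seals (stage i))

      -- Induction from the end of the escape. If it left from the head of a tree edge, its next
      -- edge would be spanned by `X τ∞` and so share its head with a tree edge or a sealed edge,
      -- both excluded further along.
      no-escape : ∀ {e} → Esc (K σ₀ ∪ᵖ S τ∞) e →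
                  Esc ((K σ₀ ∪ᵖ Y∞) ∪ᵖ S τ∞) e × (∀ y → Y∞ y → head y ≢ head e)
      no-escape (stop t) = stop t , λ y Yy q → none y Yy (T-resp (sym q) t)
      no-escape (step {f = f} arc ¬c e) with no-escape e
      ... | e′ , away = step arc ¬c′ e′ , away′
        where
        ¬c′ : ¬ cl ((K σ₀ ∪ᵖ Y∞) ∪ᵖ S τ∞) f
        ¬c′ c with cl-diff c ¬c
        ... | d , inj₁ (inj₁ k) , _ , ¬d  = ¬d (inj₁ k)
        ... | d , inj₁ (inj₂ Yd) , q , ¬d = away d Yd q
        ... | d , inj₂ s , _ , ¬d         = ¬d (inj₂ s)
        away′ : ∀ y → Y∞ y → head y ≢ _
        away′ y Yy q with cl-diff (adjacent-spanned Yy (⟶-resp (sym q) arc)) ¬c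
        ... | d , Xd , q′ , ¬d with dec (Y∞ d)
        ... | yes Yd = away d Yd q′
        ... | no ¬Yd = seals∞ d Xd (λ s → ¬d (inj₂ s))
                (λ { (inj₁ k) → ¬d (inj₁ k) ; (inj₂ Yd) → ¬Yd Yd }) (esc-resp (sym q′) e′)

      ℓ∞ : Link (σ₀ -ᴱ a) τ∞
      ℓ∞ = limit-link Λ (λ i → ⊚-extends (Λ i) (link (move i)))

      hindered : Hindered σ₀
      -- The links start from `σ₀ -ᴱ a` and never continue `a`, so seen from `σ₀` their limit
      -- abandons it.
      hindered = τ∞ , (link-source (λ x k → k) (λ x k → k) (λ x → proj₁) ℓ∞ , seals′) , a , Sa , miss
        where
        seals′ : Seals (K σ₀) τ∞
        seals′ x Xx ¬S ¬K e with no-escape e | dec (Y∞ x)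
        ... | _ , away | yes Yx = away x Yx refl
        ... | e′ , _ | no ¬Yx   = seals∞ x Xx ¬S (λ { (inj₁ k) → ¬K k ; (inj₂ Yx) → ¬Yx Yx }) e′
        N∌a : ¬ N ℓ∞ a
        N∌a n = new ℓ∞ a n (S⊑X σ₀ a Sa)
        a-last : ∀ x → N ℓ∞ x → p ℓ∞ x ≢ a
        a-last x n q with pred-ends ℓ∞ n
        ... | inj₁ (_ , ne) = ne q
        ... | inj₂ m        = N∌a (subst (N ℓ∞) q m)
        miss : ∀ l → S τ∞ l → ¬ RootOf ℓ∞ a l
        miss l Sl r with root-last a-last r
        ... | refl with ends ℓ∞ a Sl
        ... | inj₁ (_ , ne) = ne refl
        ... | inj₂ n        = N∌a n

    reaching : Reaching σ₀ a
    reaching with dec (Σ A λ y → Y∞ y × T y)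
    ... | no none = ⊥-elim (¬h₀ (Closed.hindered λ y Yy t → none (y , Yy , t)))
    ... | yes (y , (i , Yy) , Ty) with via (stage i) y Yy
    ... | ℓ , t , r = st (stage i) +ᴱ y ∣ Y⊑X (stage i) y Yy
      , (λ h → unh (stage i) (hindered-add _ y _ (Y∌S (stage i) y Yy) Ty h)) , ℓ , t , y , Ty , r

  -- Continuing all paths

  module Complete (σ₀ : State) (¬h₀ : ¬ Hindered σ₀) where

    record Stage : Set₁ where
      field
        st    : State
        unh   : ¬ Hindered st
        link  : Link σ₀ st
        total : Total link
    open Stage

    Reached : Stage → A → Set
    Reached s c = Σ A λ y → T y × RootOf (link s) c y

    record _↝[_]_ (s : Stage) (m : Maybe A) (s′ : Stage) : Set₁ where
      field
        onward  : Link (st s) (st s′)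
        extends : Extends (link s) (link s′)
        reached : ∀ c → m ≡ just c → S σ₀ c → Reached s′ c
    open _↝[_]_

    stay : ∀ {m} s → (∀ c → m ≡ just c → ¬ S σ₀ c) → Σ Stage (s ↝[ m ]_)
    stay s h = s , record { onward = proj₁ (id-wave (st s))
      ; extends = record { N-mono = λ x n → n ; p-same = λ x n → refl }
      ; reached = λ c q Sc → ⊥-elim (h c q Sc) }

    advance : ∀ m s → Σ Stage (s ↝[ m ]_)
    advance nothing s = stay s (λ c ())
    advance (just c) s with dec (S σ₀ c)
    ... | no ¬Sc = stay s (λ { _ refl → ¬Sc })
    ... | yes Sc with total s c Sc
    ... | l , Sl , r with Tree.reaching (st s) (unh s) l Sl
    ... | τ , ¬h , ℓ , t , y , Ty , r′ =
      record { st = τ ; unh = ¬h ; link = link s ⊚ ℓ ; total = ⊚-total (link s) ℓ (total s) t }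
      , record { onward = ℓ ; extends = ⊚-extends (link s) ℓ
               ; reached = λ { _ refl _ → y , Ty
                   , root-trans (Compose.root₁ (link s) ℓ r) (Compose.root₂ (link s) ℓ r′) } }

    stage : ℕ → Stage
    stage zero    = record { st = σ₀ ; unh = ¬h₀ ; link = proj₁ (id-wave σ₀) ; total = λ s Ss → s , Ss , self }
    stage (suc i) = proj₁ (advance (enum i) (stage i))

    move : ∀ i → stage i ↝[ enum i ] stage (suc i)
    move i = proj₂ (advance (enum i) (stage i))

    τ∞ : State
    τ∞ = lim (λ i → st (stage i)) (λ i → X⊑ (onward (move i)))

    open Limit (λ i → st (stage i)) τ∞ (λ i → X⊑ (onward (move i))) (λ i → link-drop (onward (move i)))
      (λ i x a → i , a) (λ x a → a) (λ x h → h) (λ x h → h)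

    ℓ∞ : Link σ₀ τ∞
    ℓ∞ = limit-link (λ i → link (stage i)) (λ i → extends (move i))

    -- Later stages keep all old predecessors, so a path that has met `T` persists in the limit.
    complete : ∀ c → S σ₀ c → Σ A λ y → T y × RootOf ℓ∞ c y
    complete c Sc with enum-hits c 0
    ... | m , _ , q with reached (move m) c q Sc
    ... | y , Ty , r = y , Ty , limit-root (λ i → link (stage i)) (λ i → extends (move i)) (suc m) r

  record Linkage (σ : State) : Set₁ where
    field
      cut-state end-state : State
      to-cut   : Wave σ cut-state
      from-cut : Link cut-state end-state
      joined   : ∀ c → S cut-state c → Σ A λ y → T y × RootOf from-cut c y

  abstract
    linkage : ∀ σ → Linkage σ
    linkage σ = record
      { cut-state = τ∞ ; end-state = Complete.τ∞ τ∞ unhindered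
      ; to-cut = limit-wave 0 ; from-cut = Complete.ℓ∞ τ∞ unhindered
      ; joined = Complete.complete τ∞ unhindered }
      where open Exhaust σ

-- An enumeration of a countable set in which every element recurs infinitely often,
-- read off the diagonal enumeration of ℕ × ℕ.
module Schedule (lem : (P : Set₁) → Dec P) {A : Set} (countable : Countable A) where
  open Classical lem
  open Injection countable using (injective) renaming (to to index)

  succ : ℕ × ℕ → ℕ × ℕ
  succ (i , zero)  = 0 , suc i
  succ (i , suc j) = suc i , j

  pair : ℕ → ℕ × ℕ
  pair zero    = 0 , 0
  pair (suc m) = succ (pair m)

  pair-onto : ∀ d i j → i + j ≡ d → Σ ℕ λ m → pair m ≡ (i , j)
  pair-onto d zero zero _ = 0 , refl
  pair-onto (suc d) zero (suc .d) refl with pair-onto d d 0 (+-identityʳ d)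
  ... | m , q = suc m , cong succ q
  pair-onto d (suc i) j eq with pair-onto d i (suc j) (trans (+-suc i j) eq)
  ... | m , q = suc m , cong succ q

  -- The second coordinate is a mere counter: the position of a pair with counter `n` is at least
  -- `n`.
  pair-bound : ∀ m → proj₁ (pair m) + proj₂ (pair m) ≤ m
  pair-bound zero = z≤n
  pair-bound (suc m) with pair m | pair-bound m
  ... | i , zero  | b = s≤s (≤-trans (≤-reflexive (sym (+-identityʳ i))) b)
  ... | i , suc j | b = ≤-trans (≤-reflexive (sym (+-suc i j))) (≤-trans b (n≤1+n m))

  enum : ℕ → Maybe A
  enum m with dec (Σ A λ a → index a ≡ proj₁ (pair m))
  ... | yes (a , _) = just a
  ... | no _        = nothing

  enum-hits : ∀ a n → Σ ℕ λ m → n ≤ m × enum m ≡ just a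
  enum-hits a n with pair-onto _ (index a) n refl
  ... | m , q = m , ≤-trans (m≤n+m n (index a)) (subst (λ r → proj₁ r + proj₂ r ≤ m) q (pair-bound m)) , hit
    where
    hit : enum m ≡ just a
    hit with dec (Σ A λ a → index a ≡ proj₁ (pair m))
    ... | yes (b , r) = cong just (injective (trans r (cong proj₁ q)))
    ... | no none     = ⊥-elim (none (a , sym (cong proj₁ q)))

-- Shortening walks to paths

module Walks (lem : (P : Set₁) → Dec P) (D : Digraph) where
  open Digraph D
  open Classical lem

  walk-snoc : ∀ {u v es e} → Walk D u v es → tail e ≡ v → Walk D u (head e) (es ++ e ∷ [])
  walk-snoc walk-nil q        = walk-cons q walk-nil
  walk-snoc (walk-cons r w) q = walk-cons r (walk-snoc w q)

  Shortened : V → V → List A → Set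
  Shortened u w es = Σ (List A) λ fs → IsPath D u w fs × (∀ e → e ∈ˡ fs → e ∈ˡ es)

  suffix : ∀ {u v w es} → IsPath D v w es → u ∈ˡ v ∷ map head es → Shortened u w es
  suffix {es = es} P (here refl) = es , P , λ e m → m
  suffix (walk-cons _ w , _ ∷ uniq) (there m) with suffix (w , uniq) m
  ... | fs , P , fs≤ = fs , P , λ e n → there (fs≤ e n)

  shorten : ∀ {u w es} → Walk D u w es → Shortened u w es
  shorten walk-nil = [] , (walk-nil , [] ∷ []) , λ e m → m
  shorten {u} {es = e ∷ es} (walk-cons q w) with shorten w
  ... | fs , P , fs≤ with dec (u ∈ˡ head e ∷ map head fs)
  ... | no ∉ = e ∷ fs , (walk-cons q (proj₁ P) , ¬Any⇒All¬ _ ∉ ∷ proj₂ P)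
             , λ { x (here r) → here r ; x (there m) → there (fs≤ x m) }
  ... | yes ∈ with suffix P ∈
  ... | gs , P′ , gs≤ = gs , P′ , λ x m → there (fs≤ x (gs≤ x m))

-- Assembling the path system and its cut

module Main (lem : (P : Set₁) → Dec P) (D : Digraph) (countable : Countable (Digraph.A D))
            (s t : Digraph.V D) (s≢t : s ≢ t) (M : (v : Digraph.V D) → FinitaryMatroid (In D v)) where
  open Digraph D
  open Classical lem
  open Schedule lem countable using (enum; enum-hits)
  open Walks lem D
  open SumClosure lem D M public

  _⟶_ : A → A → Set
  e ⟶ f = head e ≡ tail f × head e ≢ t

  T : Pred A 0ℓ
  T e = head e ≡ t

  ⟶-resp : ∀ {x y f} → head x ≡ head y → x ⟶ f → y ⟶ f
  ⟶-resp q (a , b) = trans (sym q) a , λ r → b (trans q r)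

  T-resp : ∀ {x y} → head x ≡ head y → T x → T y
  T-resp q r = trans (sym q) r

  T-stop : ∀ {x f} → T x → ¬ (x ⟶ f)
  T-stop r (_ , b) = b r

  open Web lem head _⟶_ T
    ⟶-resp T-resp T-stop
    cl cl-mono cl-ext cl-trans cl-exch cl-local cl-fin enum enum-hits public

  -- The fundamental circuit consists of `e` and all `x` in `C` for which `C ⊖ x ⊕ e` is
  -- independent. This makes minimality immediate; dependence comes from `critical`.
  cl⇒span : ∀ {C e} → Free C → cl C e → span (⊕Indep D M) C e
  cl⇒span {C} {e} fr c with dec (C e)
  ... | yes Ce = inj₁ (lift Ce)
  ... | no ¬Ce = inj₂ (circuit , (dependent , proper) , inj₁ refl
               , λ { (inj₁ q) → inj₂ (sym q) ; (inj₂ (Cx , _)) → inj₁ Cx })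
    where
    Critical circuit : Pred A 0ℓ
    Critical x = C x × ⊕Indep D M (C ⊖ x ⊕ e)
    circuit x  = x ≡ e ⊎ Critical x
    dependent : ¬ ⊕Indep D M circuit
    dependent i with critical fr (λ x → proj₁) c (λ c′ → indep⇒free i e (inj₁ refl)
      (cl-mono (λ x z → inj₂ z , λ { refl → ¬Ce (proj₁ z) }) c′))
    ... | d , Cd , ¬d , ¬c = ¬d (Cd , free⇒indep (free-add (free-mono (λ x → proj₁) fr) ¬c))
    proper : ∀ Y → Y ⊆ circuit → ¬ (circuit ⊆ Y) → ⊕Indep D M Y
    proper Y Y⊆ ¬⊆ with dne (λ none → ¬⊆ λ {x} cx → dne λ ¬Yx → none (x , cx , ¬Yx))
    ... | k , inj₁ refl , ¬Yk = free⇒indep (free-mono below fr)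
      where
      below : ∀ x → Y x → C x
      below x Yx with Y⊆ Yx
      ... | inj₁ refl = ⊥-elim (¬Yk Yx)
      ... | inj₂ z    = proj₁ z
    ... | k , inj₂ (Ck , i) , ¬Yk = free⇒indep (free-mono below (indep⇒free i))
      where
      below : ∀ x → Y x → (C ⊖ k ⊕ e) x
      below x Yx with Y⊆ Yx
      ... | inj₁ q        = inj₂ q
      ... | inj₂ (Cx , _) = inj₁ (Cx , λ { refl → ¬Yk Yx })

  B : Pred A 0ℓ
  B = proj₁ (basis (λ e → tail e ≡ s))

  source : State
  source = record { X = B ; S = B ; free = proj₁ (proj₂ (basis _)) ; S⊑X = λ x b → b }

  open Linkage (linkage source) public

  ℓ₁ = proj₁ to-cut
  ℓ  = ℓ₁ ⊚ from-cut

  C : Pred A 0ℓ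
  C = S cut-state

  -- `B` spans the first edge. If the path avoids `cl C`, some `d` in `B` outside `C` has the head
  -- of that edge, and the rest of the path is an escape from `d`; but `d` is sealed, because
  -- `K source` is empty.
  covered : ∀ P → IsPath D s t P → Σ A λ e → e ∈ˡ P × cl C e
  covered [] (walk-nil , _) = ⊥-elim (s≢t refl)
  covered (e ∷ es) (walk-cons q w , _) = dne λ none → absurd λ f m c → none (f , m , c)
    where
    escape : ∀ {u es} → Walk D u t es → (∀ f → f ∈ˡ es → ¬ cl C f) → ∀ x → head x ≡ u → Esc (K source ∪ᵖ C) x
    escape walk-nil h x q = stop q
    escape (walk-cons {e = f} r w) h x q with dec (head x ≡ t)
    ... | yes x∈T = stop x∈T
    ... | no x∉T  = step (trans q (sym r) , x∉T)
      (λ c → h f (here refl) (cl-mono (λ { y (inj₁ (b , ¬b)) → ⊥-elim (¬b b) ; y (inj₂ z) → z }) c))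
      (escape w (λ g m → h g (there m)) f refl)
    absurd : ¬ (∀ f → f ∈ˡ e ∷ es → ¬ cl C f)
    absurd h with cl-diff (proj₂ (proj₂ (proj₂ (basis _))) e q) (h e (here refl))
    ... | d , Bd , hd , ¬Cd = proj₂ to-cut d (X⊑ ℓ₁ d Bd) ¬Cd (λ (b , ¬b) → ¬b b)
      (escape w (λ g m → h g (there m)) d hd)

  Goal : A → Set
  Goal y = T y × Σ A λ c → C c × RootOf ℓ c y

  On : A → A → Set
  On y e = RootOf ℓ e y × X end-state e

  trace : ∀ {y} → Trail B (N ℓ) (p ℓ) y →
          Σ (List A) λ es → Walk D s (head y) es × (∀ e → e ∈ˡ es → On y e)
  trace (base {y} b) = y ∷ [] , walk-cons (proj₁ (proj₂ (proj₂ (basis _))) y b) walk-nil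
                     , λ { e (here refl) → self , X⊑ ℓ y b }
  trace (next {y} n (q , _) tr) with trace tr
  ... | es , w , on = es ++ y ∷ [] , walk-snoc w (sym q) , on′
    where
    on′ : ∀ e → e ∈ˡ es ++ y ∷ [] → On y e
    on′ e m with ∈-++⁻ es m
    ... | inj₁ m′          = next n (proj₁ (on e m′)) , proj₂ (on e m′)
    ... | inj₂ (here refl) = self , N⊑ ℓ y n

  goal-trail : ∀ {y} → Goal y → Trail B (N ℓ) (p ℓ) y
  goal-trail (_ , c , Cc , r) with root-inv r
  ... | inj₂ (n , _) = wf ℓ _ n
  ... | inj₁ refl with ends ℓ₁ c Cc
  ... | inj₁ b = base b
  ... | inj₂ n = wf ℓ c (inj₁ n)

  route : ∀ {y} → Goal y → Σ (List A) λ es → IsPath D s t es × (∀ e → e ∈ˡ es → On y e)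
  route g@(q , _) with trace (goal-trail g)
  ... | es , w , on with shorten w
  ... | fs , P , fs≤ = fs , subst (λ v → IsPath D s v fs) q P , λ e m → on e (fs≤ e m)

  -- Deciding `Goal y` fixes one proof, so the path depends on `y` alone and equal ends give equal
  -- paths. The empty list is a dummy for edges that end no path.
  path : A → List A
  path y with dec (Goal y)
  ... | yes g = proj₁ (route g)
  ... | no _  = []

  path-spec : ∀ {y} → Goal y → IsPath D s t (path y) × (∀ e → e ∈ˡ path y → On y e)
  path-spec {y} g with dec (Goal y)
  ... | yes g′ = proj₂ (route g′)
  ... | no ¬g  = ⊥-elim (¬g g)

  goal-last : ∀ {y} → Goal y → ∀ x → N ℓ x → p ℓ x ≢ y
  goal-last (q , _) x n refl = proj₂ (proj₁ (trail-next ℓ n)) q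

  same-goal : ∀ {y y′ e} → Goal y → Goal y′ → RootOf ℓ e y → RootOf ℓ e y′ → y ≡ y′
  same-goal g g′ r r′ with root-comparable (inj ℓ) r r′
  ... | inj₁ q = root-last (goal-last g) q
  ... | inj₂ q = sym (root-last (goal-last g′) q)

  cut-last : ∀ {c d} → C c → C d → RootOf ℓ c d → c ≡ d
  cut-last {c} {d} Cc Cd r =
    root-last (last≢ ℓ₁ Cc) (Compose.root-lower ℓ₁ from-cut (S⊑X cut-state d Cd) r)

  -- Walking back from `y` until one of the two is met puts the other before it, while `cut-last`
  -- says that no edge of `C` precedes another.
  cut-unique : ∀ {y c d} → C c → C d → RootOf ℓ c y → RootOf ℓ d y → c ≡ d
  cut-unique Cc Cd r r′ = meet Cc Cd r r′
    where
    meet : ∀ {y c d} → C c → C d → RootOf ℓ c y → RootOf ℓ d y → c ≡ d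
    meet Cc Cd self r′ = sym (cut-last Cd Cc r′)
    meet Cc Cd r self = cut-last Cc Cd r
    meet Cc Cd (next _ r) (next _ r′) = meet Cc Cd r r′

  -- Every path must meet cl C, and an element of cl C in the independent set X end-state lies in C.
  crossing : ∀ {y} → Goal y → Σ A λ e → e ∈ˡ path y × C e
  crossing {y} g with path-spec g
  ... | P , on with covered (path y) P
  ... | e , m , c = e , m , free-mem (free end-state)
          (λ x Cx → X⊑ from-cut x (S⊑X cut-state x Cx)) (proj₂ (on e m)) c

  𝒫 : Pred (List A) 0ℓ
  𝒫 P = Σ A λ y → Goal y × P ≡ path y

  cut-goal : ∀ {c} → C c → Σ A λ y → Goal y × RootOf ℓ c y
  cut-goal {c} Cc with joined c Cc
  ... | y , Ty , r = y , (Ty , c , Cc , r′) , r′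
    where r′ = Compose.root₂ ℓ₁ from-cut r

  on-path : ∀ {c} → C c → Σ (List A) λ P → 𝒫 P × c ∈ˡ P
  on-path Cc with cut-goal Cc
  ... | y , g , r with crossing g
  ... | e , m , Ce with cut-unique Cc Ce r (proj₁ (proj₂ (path-spec g) e m))
  ... | refl = path y , (y , g , refl) , m

theorem3 : (lem : (P : Set₁) → Dec P) →
    (D : Digraph) → Countable (Digraph.V D) → Countable (Digraph.A D) →
    (s t : Digraph.V D) → s ≢ t →
    (M : (v : Digraph.V D) → FinitaryMatroid (In D v)) →
    Σ (Pred (List (Digraph.A D)) 0ℓ) λ 𝒫 →
    (∀ P → P ∈ 𝒫 → IsPath D s t P) ×
    (∀ P Q → P ∈ 𝒫 → Q ∈ 𝒫 → P ≢ Q → ∀ e → e ∈ˡ P → ¬ (e ∈ˡ Q)) ×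
    ⊕Indep D M (λ e → Σ (List (Digraph.A D)) λ P → P ∈ 𝒫 × e ∈ˡ P) ×
    Σ (Pred (Digraph.A D) 0ℓ) λ C →
    (∀ e → e ∈ C → Σ (List (Digraph.A D)) λ P → P ∈ 𝒫 × e ∈ˡ P) ×
    (∀ P → P ∈ 𝒫 → ∃ λ e → e ∈ˡ P × e ∈ C) ×
    (∀ P → P ∈ 𝒫 → ∀ e e′ → e ∈ˡ P → e ∈ C → e′ ∈ˡ P → e′ ∈ C → e ≡ e′) ×
    (∀ P → IsPath D s t P → ∃ λ e → e ∈ˡ P × span (⊕Indep D M) C e)
theorem3 lem D _ countable s t s≢t M =
    𝒫
  , (λ { _ (y , g , refl) → proj₁ (path-spec g) })
  , (λ { _ _ (y , g , refl) (y′ , g′ , refl) P≢Q e m m′ → P≢Q (cong path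
      (same-goal g g′ (proj₁ (proj₂ (path-spec g) e m)) (proj₁ (proj₂ (path-spec g′) e m′)))) })
  , free⇒indep (free-mono (λ { e (_ , (y , g , refl) , m) → proj₂ (proj₂ (path-spec g) e m) }) (free end-state))
  , C
  , (λ e → on-path)
  , (λ { _ (y , g , refl) → crossing g })
  , (λ { _ (y , g , refl) e e′ m Ce m′ Ce′ →
      cut-unique Ce Ce′ (proj₁ (proj₂ (path-spec g) e m)) (proj₁ (proj₂ (path-spec g) e′ m′)) })
  , λ P isPath → let e , m , c = covered P isPath in
      e , m , cl⇒span (free-mono (S⊑X cut-state) (free cut-state)) c
  where
  open Main lem D countable s t s≢t M
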